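{- Let $G=(V,E)$ be a finite digraph and $p\geq 2$ an integer. Then $G$ has a nowhere-zero $p$-flow if and only if there exists a map $\psi:E\to\{0,1,\dots,p-2\}$ such that the number of even $\psi$-conformal dual $p$-flows on $G$ is not equal to the number of odd $\psi$-conformal dual $p$-flows on $G$.
   Context: $\mathbb{Z}_p=\{0,1,\dots,p-1\}$ denotes the additive group of integers modulo $p$. For a vertex $v$, $\delta^-(v)$ is the set of arcs with head $v$ and $\delta^+(v)$ the set of arcs with tail $v$. A $p$-flow on $G$ is a map $\phi:E\to\mathbb{Z}_p$ with $\sum_{e\in\delta^-(v)}\phi(e)-\sum_{e\in\delta^+(v)}\phi(e)=0$ in $\mathbb{Z}_p$ for every vertex $v$; it is nowhere-zero if $\phi(e)\neq 0$ for all $e$. A dual $p$-flow is a map $\phi:E\to\mathbb{Z}_p$ such that for every circuit (cycle) $C$ of the underlying undirected graph, traversed in one of its directions, the signed sum of $\phi(e)$ over $e\in C$ (with sign $+$ for arcs traversed along their orientation and $-$ for arcs traversed against it) is $0$ in $\mathbb{Z}_p$. A map $\phi:E\to\mathbb{Z}_p$ is even if $|\phi^{ -1}(p-1)|$ is even, and odd otherwise. For $\psi:E\to\{0,\dots,p-2\}$, a map $\phi:E\to\mathbb{Z}_p$ is $\psi$-conformal if $\phi(e)\in\{\psi(e),p-1\}$ for every arc $e$. -}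

module Defs where

open import Data.Nat using (ℕ; zero; suc; _+_; _∸_; _%_; _≥_; NonZero)
import Data.Nat as ℕ
open import Data.Nat.DivMod using (m%n<n)
open import Data.Fin using (fromℕ<)
open import Data.Fin using (Fin; toℕ; zero; suc)
open import Data.Fin.Properties using (_≟_)
open import Data.Bool using (Bool; true; false; if_then_else_)
open import Data.Vec using (Vec; lookup)
open import Data.List using (List; length)
open import Data.List.Membership.Propositional using (_∈_)
open import Data.List.Relation.Unary.All using (All)
open import Data.List.Relation.Unary.Unique.Propositional using (Unique)
open import Data.Product using (Σ; _×_)
open import Data.Sum using (_⊎_)
open import Function.Definitions using (Injective)
open import Relation.Nullary.Decidable using (does)
open import Relation.Binary.PropositionalEquality using (_≡_; _≢_)

-- A finite digraph with vertex set Fin n and arc set Fin m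
-- (loops and parallel arcs allowed); each arc has a tail and a head.
record Digraph : Set where
  field
    n    : ℕ
    m    : ℕ
    tail : Fin m → Fin n
    head : Fin m → Fin n
open Digraph public

Σ[<] : (k : ℕ) → (Fin k → ℕ) → ℕ
Σ[<] zero    f = 0
Σ[<] (suc k) f = f zero + Σ[<] k (λ i → f (suc i))

-- Z_p is represented by Fin p; sums are compared modulo p.

IsFlow : (G : Digraph) (p : ℕ) .{{_ : NonZero p}} → (Fin (m G) → Fin p) → Set
IsFlow G p φ = ∀ (v : Fin (n G)) →
  Σ[<] (m G) (λ e → if does (head G e ≟ v) then toℕ (φ e) else 0) % p
    ≡ Σ[<] (m G) (λ e → if does (tail G e ≟ v) then toℕ (φ e) else 0) % p

NowhereZero : {m p : ℕ} → (Fin m → Fin p) → Set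
NowhereZero {m} φ = ∀ (e : Fin m) → toℕ (φ e) ≢ 0

next : {k : ℕ} → Fin k → Fin k
next {suc k} i = fromℕ< (m%n<n (suc (toℕ i)) (suc k))

-- A circuit of the underlying undirected graph, traversed in a direction:
-- length k ≥ 1, pairwise distinct arcs arc i, pairwise distinct vertices vert i,
-- and step i goes from vert i to vert (i+1 mod k) along arc i, forward
-- (dir i = true: tail = vert i, head = vert (i+1)) or backward (dir i = false).
record Circuit (G : Digraph) : Set where
  field
    len      : ℕ
    len≥1    : len ≥ 1
    arc      : Fin len → Fin (m G)
    dir      : Fin len → Bool
    vert     : Fin len → Fin (n G)
    arc-inj  : Injective _≡_ _≡_ arc
    vert-inj : Injective _≡_ _≡_ vert
    step     : ∀ i → if dir i
                     then (tail G (arc i) ≡ vert i × head G (arc i) ≡ vert (next i))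
                     else (head G (arc i) ≡ vert i × tail G (arc i) ≡ vert (next i))

IsDualFlow : (G : Digraph) (p : ℕ) .{{_ : NonZero p}} → (Fin (m G) → Fin p) → Set
IsDualFlow G p φ = ∀ (C : Circuit G) →
  let open Circuit C in
  Σ[<] len (λ i → if dir i then toℕ (φ (arc i)) else 0) % p
    ≡ Σ[<] len (λ i → if dir i then 0 else toℕ (φ (arc i))) % p

#top : {m p : ℕ} → (Fin m → Fin p) → ℕ
#top {m} {p} φ = Σ[<] m (λ e → if does (toℕ (φ e) ℕ.≟ (p ∸ 1)) then 1 else 0)

IsEven IsOdd : {m p : ℕ} → (Fin m → Fin p) → Set
IsEven φ = #top φ % 2 ≡ 0
IsOdd  φ = #top φ % 2 ≡ 1

Conformal : {m p : ℕ} → (Fin m → Fin (p ∸ 1)) → (Fin m → Fin p) → Set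
Conformal {m} {p} ψ φ = ∀ e → toℕ (φ e) ≡ toℕ (ψ e) ⊎ toℕ (φ e) ≡ p ∸ 1

-- "the number of maps E → Z_p (as vectors) satisfying P is k":
-- a duplicate-free list of length k containing exactly the maps satisfying P.
HasCount : {m p : ℕ} → ((Fin m → Fin p) → Set) → ℕ → Set
HasCount {m} {p} P k = Σ (List (Vec (Fin p) m)) λ xs →
  Unique xs × length xs ≡ k × All (λ v → P (lookup v)) xs
    × (∀ (v : Vec (Fin p) m) → P (lookup v) → v ∈ xs)

{-# OPTIONS --safe #-}

-- For potentials π : V → ℤ_p let δπ be the tension e ↦ π(head e) − π(tail e), and put
-- K(x,y) = p[x = y] − 1, the kernel (up to the factor p) of the projection onto functions of sum
-- zero on ℤ_p.  Write F(y) = Σ_π Π_e K(δπ(e), y(e)) for y : E → ℤ_p.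
--
-- * Deletion and contraction of arcs show that F(0) is pⁿ times the number of nowhere-zero p-flows.
-- * The functions D_a = [· = a] − [· = p−1], a < p−1, span the functions of sum zero, so F(0) is
--   a combination of the numbers N(ψ) = Σ_π Π_e D_ψ(e)(δπ(e)).  Conversely p^m N(ψ) is a combination
--   of the F(y), and these all vanish with F(0), because K² = pK and translation of potentials
--   give Σ_y F(y)² = p^m pⁿ F(0).
-- * N(ψ) counts potentials of even minus odd ψ-conformal tensions, and every tension has the same
--   number of potentials.
-- * Dual flows are tensions: adding the arcs one at a time, an arc within a component of the
--   previous ones closes a circuit, and otherwise the potential can be shifted on one component.
module Submission where

open import Defs
open import Data.Nat as ℕ using (ℕ; zero; suc; _≥_; _∸_; >-nonZero; s≤s; z≤n)
open import Data.Nat.Properties using (≤-trans)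
import Data.Nat.Divisibility as ℕ
import Data.Nat.DivMod as ℕ
import Data.Nat.Properties as ℕ
open import Data.Integer using (ℤ; +_; -[1+_]; _+_; _*_; _-_; -_; 0ℤ; 1ℤ; _^_; ∣_∣; +≤+) renaming (_≤_ to _≤ℤ_)
open import Data.Integer.Divisibility.Signed using (_∣_; _∣?_; divides; ∣⇒∣ᵤ; ∣m∣n⇒∣m+n; ∣m⇒∣-m; ∣n⇒∣m*n)
open import Data.Integer.DivMod using (_/ℕ_; n%ℕd<d; a≡a%ℕn+[a/ℕn]*n)
import Data.Integer.Properties as ℤ
open import Data.Integer.Tactic.RingSolver using (solve-∀)
open import Data.Bool using (Bool; true; false; if_then_else_; not)
open import Data.Fin using (Fin; zero; suc; toℕ; inject₁; fromℕ; fromℕ<; _≟_)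
open import Data.Fin.Properties using (toℕ<n; toℕ-fromℕ; toℕ-fromℕ<; toℕ-inject₁; toℕ-injective; all?) renaming (any? to anyFin?)
open import Data.Fin.Relation.Unary.Top using (view; ‵fromℕ; ‵inject₁)
open import Data.List as List using (List; []; _∷_; _++_; length; filter; allFin; cartesianProductWith)
open import Data.List.Membership.DecPropositional using () renaming (_∈?_ to mem?)
open import Data.List.Membership.Propositional using (find; lose; _∈_; _∉_)
open import Data.List.Membership.Propositional.Properties using (∈-allFin; ∈-cartesianProductWith⁺; ∈-filter⁺; ∈-filter⁻)
open import Data.List.Membership.Propositional.Properties.WithK using (unique∧set⇒bag)
import Data.List.Properties as List
open import Data.List.Relation.Binary.BagAndSetEquality using (∼bag⇒↭)
open import Data.List.Relation.Binary.Permutation.Propositional.Properties using (↭-length)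
open import Data.List.Relation.Unary.All as All using (All; []; _∷_)
open import Data.List.Relation.Unary.All.Properties using (all-filter)
open import Data.List.Relation.Unary.AllPairs using ([]; _∷_)
open import Data.List.Relation.Unary.Any using (any?; here; there)
open import Data.List.Relation.Unary.Unique.Propositional using (Unique)
open import Data.List.Relation.Unary.Unique.Propositional.Properties using (allFin⁺; cartesianProductWith⁺; filter⁺)
open import Data.Product using (Σ; ∃; ∃₂; _×_; _,_; proj₂)
open import Data.Sum using (_⊎_; inj₁; inj₂; [_,_])
open import Data.Unit using (⊤; tt)
open import Data.Vec using (Vec; []; _∷_; lookup; _[_]≔_; tabulate; replicate)
import Data.Vec.Properties as Vec
open import Function using (_∘_; id)
open import Function.Bundles using (_⇔_; mk⇔; Equivalence)
open import Function.Definitions using (Injective)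
open import Relation.Binary.Construct.Closure.ReflexiveTransitive as Star using (Star; ε; _◅_; _◅◅_)
open import Relation.Binary.Definitions using (DecidableEquality)
open import Relation.Binary.PropositionalEquality using (_≡_; _≢_; refl; sym; trans; cong; cong₂; subst; module ≡-Reasoning)
open import Relation.Nullary using (Dec; yes; no; does; ¬_; contradiction)
open import Relation.Nullary.Decidable using (_×-dec_; _⊎-dec_; map′)
open ≡-Reasoning

private variable
  A B : Set
  k l : ℕ

-- Finite sums and products

+-congʳ : ∀ a {b c : ℤ} → b ≡ c → a + b ≡ a + c
+-congʳ a = cong (λ x → a + x)

∑ : List A → (A → ℤ) → ℤ
∑ []       f = 0ℤ
∑ (x ∷ xs) f = f x + ∑ xs f

∑-cong : ∀ (xs : List A) {f g : A → ℤ} → (∀ x → f x ≡ g x) → ∑ xs f ≡ ∑ xs g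
∑-cong []       eq = refl
∑-cong (x ∷ xs) eq = cong₂ _+_ (eq x) (∑-cong xs eq)

∑-zero : ∀ (xs : List A) → ∑ xs (λ _ → 0ℤ) ≡ 0ℤ
∑-zero []       = refl
∑-zero (x ∷ xs) = trans (ℤ.+-identityˡ _) (∑-zero xs)

∑-+ : ∀ (xs : List A) (f g : A → ℤ) → ∑ xs (λ x → f x + g x) ≡ ∑ xs f + ∑ xs g
∑-+ []       f g = refl
∑-+ (x ∷ xs) f g = trans (+-congʳ (f x + g x) (∑-+ xs f g)) (interchange (f x) (g x) _ _)
  where
  interchange : ∀ a b c d → (a + b) + (c + d) ≡ (a + c) + (b + d)
  interchange = solve-∀

∑-*ˡ : ∀ (xs : List A) c (f : A → ℤ) → ∑ xs (λ x → c * f x) ≡ c * ∑ xs f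
∑-*ˡ []       c f = sym (ℤ.*-zeroʳ c)
∑-*ˡ (x ∷ xs) c f = trans (+-congʳ (c * f x) (∑-*ˡ xs c f)) (sym (ℤ.*-distribˡ-+ c (f x) _))

∑-*ʳ : ∀ (xs : List A) c (f : A → ℤ) → ∑ xs (λ x → f x * c) ≡ ∑ xs f * c
∑-*ʳ xs c f = trans (∑-cong xs λ x → ℤ.*-comm (f x) c) (trans (∑-*ˡ xs c f) (ℤ.*-comm c _))

∑-neg : ∀ (xs : List A) (f : A → ℤ) → ∑ xs (λ x → - f x) ≡ - ∑ xs f
∑-neg []       f = refl
∑-neg (x ∷ xs) f = trans (+-congʳ (- f x) (∑-neg xs f)) (sym (ℤ.neg-distrib-+ (f x) _))

∑-minus : ∀ (xs : List A) (f g : A → ℤ) → ∑ xs (λ x → f x - g x) ≡ ∑ xs f - ∑ xs g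
∑-minus xs f g = trans (∑-+ xs f _) (+-congʳ (∑ xs f) (∑-neg xs g))

∑-swap : ∀ (xs : List A) (ys : List B) (f : A → B → ℤ) →
  ∑ xs (λ x → ∑ ys (f x)) ≡ ∑ ys (λ y → ∑ xs (λ x → f x y))
∑-swap []       ys f = sym (∑-zero ys)
∑-swap (x ∷ xs) ys f = trans (+-congʳ (∑ ys (f x)) (∑-swap xs ys f)) (sym (∑-+ ys (f x) _))

∑-++ : ∀ (xs ys : List A) (f : A → ℤ) → ∑ (xs ++ ys) f ≡ ∑ xs f + ∑ ys f
∑-++ []       ys f = sym (ℤ.+-identityˡ _)
∑-++ (x ∷ xs) ys f = trans (+-congʳ (f x) (∑-++ xs ys f)) (sym (ℤ.+-assoc (f x) _ _))

∑-map : ∀ (g : B → A) xs (f : A → ℤ) → ∑ (List.map g xs) f ≡ ∑ xs (f ∘ g)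
∑-map g []       f = refl
∑-map g (x ∷ xs) f = +-congʳ (f (g x)) (∑-map g xs f)

∑-const : ∀ (xs : List A) c → ∑ xs (λ _ → c) ≡ + length xs * c
∑-const []       c = refl
∑-const (x ∷ xs) c = trans (+-congʳ c (∑-const xs c)) (sym (ℤ.suc-* (+ length xs) c))

-- Equality of integers is decidable, so the list can be searched. This turns a nonvanishing count
-- into a witness.
∑-≢0 : ∀ (xs : List A) (f : A → ℤ) → ∑ xs f ≢ 0ℤ → ∃ λ x → f x ≢ 0ℤ
∑-≢0 []       f ≢0 = contradiction refl ≢0
∑-≢0 (x ∷ xs) f ≢0 with f x ℤ.≟ 0ℤ
... | no  fx≢0 = x , fx≢0
... | yes fx≡0 = ∑-≢0 xs f λ ∑≡0 → ≢0 (cong₂ _+_ fx≡0 ∑≡0)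

∑-≥0 : ∀ (xs : List A) (f : A → ℤ) → (∀ x → 0ℤ ≤ℤ f x) → 0ℤ ≤ℤ ∑ xs f
∑-≥0 []       f f≥0 = ℤ.≤-refl
∑-≥0 (x ∷ xs) f f≥0 = ℤ.+-mono-≤ (f≥0 x) (∑-≥0 xs f f≥0)

-- The first term is at most the whole sum, since the remaining terms are nonnegative. It therefore
-- vanishes, and the rest again sums to zero.
∑≡0⇒≡0 : ∀ (xs : List A) (f : A → ℤ) → (∀ x → 0ℤ ≤ℤ f x) → ∑ xs f ≡ 0ℤ → ∀ {x} → x ∈ xs → f x ≡ 0ℤ
∑≡0⇒≡0 (x ∷ xs) f f≥0 ∑≡0 (here refl) = ℤ.≤-antisym
  (subst (f x ≤ℤ_) ∑≡0 (subst (_≤ℤ f x + ∑ xs f) (ℤ.+-identityʳ _) (ℤ.+-monoʳ-≤ (f x) (∑-≥0 xs f f≥0))))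
  (f≥0 x)
∑≡0⇒≡0 (x ∷ xs) f f≥0 ∑≡0 (there x∈xs) = ∑≡0⇒≡0 xs f f≥0 ∑xs≡0 x∈xs
  where
  ∑xs≡0 : ∑ xs f ≡ 0ℤ
  ∑xs≡0 = trans (sym (ℤ.+-identityˡ _)) (trans (cong (_+ ∑ xs f) (sym (∑≡0⇒≡0 (x ∷ xs) f f≥0 ∑≡0 (here refl)))) ∑≡0)

∑-allFin-suc : ∀ n (f : Fin (suc n) → ℤ) → ∑ (allFin (suc n)) f ≡ f zero + ∑ (allFin n) (f ∘ suc)
∑-allFin-suc n f = +-congʳ (f zero)
  (trans (cong (λ xs → ∑ xs f) (sym (List.map-tabulate (λ i → i) suc))) (∑-map suc (allFin n) f))

-- Splitting at the last index serves the residue `p - 1` and the wrap-around of a circuit.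
∑-allFin-last : ∀ n (f : Fin (suc n) → ℤ) →
  ∑ (allFin (suc n)) f ≡ ∑ (allFin n) (f ∘ inject₁) + f (fromℕ n)
∑-allFin-last zero    f = ℤ.+-comm (f zero) 0ℤ
∑-allFin-last (suc n) f = begin
  ∑ (allFin (suc (suc n))) f
    ≡⟨ ∑-allFin-suc (suc n) f ⟩
  f zero + ∑ (allFin (suc n)) (f ∘ suc)
    ≡⟨ +-congʳ (f zero) (∑-allFin-last n (f ∘ suc)) ⟩
  f zero + (∑ (allFin n) (f ∘ suc ∘ inject₁) + f (suc (fromℕ n)))
    ≡⟨ ℤ.+-assoc (f zero) _ _ ⟨
  f zero + ∑ (allFin n) (f ∘ suc ∘ inject₁) + f (suc (fromℕ n))
    ≡⟨ cong (_+ f (suc (fromℕ n))) (∑-allFin-suc n (f ∘ inject₁)) ⟨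
  ∑ (allFin (suc n)) (f ∘ inject₁) + f (fromℕ (suc n)) ∎

∑-allFin-const : ∀ n c → ∑ (allFin n) (λ _ → c) ≡ + n * c
∑-allFin-const n c = trans (∑-const (allFin n) c) (cong (λ k → + k * c) {length (allFin n)} {n} (List.length-tabulate (λ i → i)))

∏ : (Fin k → ℤ) → ℤ
∏ {zero}  f = 1ℤ
∏ {suc m} f = f zero * ∏ (f ∘ suc)

∏-cong : {f g : Fin k → ℤ} → (∀ e → f e ≡ g e) → ∏ f ≡ ∏ g
∏-cong {zero}  eq = refl
∏-cong {suc m} eq = cong₂ _*_ (eq zero) (∏-cong (eq ∘ suc))

*-interchange : ∀ a b c d → (a * b) * (c * d) ≡ (a * c) * (b * d)
*-interchange = solve-∀

∏-* : (f g : Fin k → ℤ) → ∏ (λ e → f e * g e) ≡ ∏ f * ∏ g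
∏-* {zero}  f g = refl
∏-* {suc m} f g = trans (cong ((f zero * g zero) *_) (∏-* (f ∘ suc) (g ∘ suc)))
  (*-interchange (f zero) (g zero) _ _)

∏-const : ∀ m c → ∏ {m} (λ _ → c) ≡ c ^ m
∏-const zero    c = refl
∏-const (suc m) c = cong (c *_) (∏-const m c)

-- Enumeration of vectors and distributivity

vecs : List A → ∀ m → List (Vec A m)
vecs xs zero    = [] ∷ []
vecs xs (suc m) = cartesianProductWith _∷_ xs (vecs xs m)

∑-cartesianProductWith : ∀ {C : Set} (g : A → B → C) xs ys (f : C → ℤ) →
  ∑ (cartesianProductWith g xs ys) f ≡ ∑ xs (λ x → ∑ ys (λ y → f (g x y)))
∑-cartesianProductWith g []       ys f = refl
∑-cartesianProductWith g (x ∷ xs) ys f = trans (∑-++ (List.map (g x) ys) _ f)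
  (cong₂ _+_ (∑-map (g x) ys f) (∑-cartesianProductWith g xs ys f))

-- Expanding the product picks one summand from each factor. The choices are recorded as vectors,
-- whose equality is decidable when that of the entries is.
∏-∑ : ∀ m (xs : List A) (g : Fin m → A → ℤ) →
  ∏ (λ e → ∑ xs (g e)) ≡ ∑ (vecs xs m) (λ y → ∏ (λ e → g e (lookup y e)))
∏-∑ zero    xs g = refl
∏-∑ (suc m) xs g = begin
  ∑ xs (g zero) * ∏ (λ e → ∑ xs (g (suc e)))
    ≡⟨ cong (∑ xs (g zero) *_) (∏-∑ m xs (g ∘ suc)) ⟩
  ∑ xs (g zero) * ∑ (vecs xs m) (λ y → ∏ (λ e → g (suc e) (lookup y e)))
    ≡⟨ ∑-*ʳ xs _ (g zero) ⟨
  ∑ xs (λ x → g zero x * ∑ (vecs xs m) (λ y → ∏ (λ e → g (suc e) (lookup y e))))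
    ≡⟨ ∑-cong xs (λ x → sym (∑-*ˡ (vecs xs m) (g zero x) _)) ⟩
  ∑ xs (λ x → ∑ (vecs xs m) (λ y → g zero x * ∏ (λ e → g (suc e) (lookup y e))))
    ≡⟨ ∑-cartesianProductWith _∷_ xs (vecs xs m) _ ⟨
  ∑ (vecs xs (suc m)) (λ y → ∏ (λ e → g e (lookup y e))) ∎

-- Indicators

χ : Dec A → ℤ
χ a? = if does a? then 1ℤ else 0ℤ

χ-yes : (a? : Dec A) → A → χ a? ≡ 1ℤ
χ-yes (yes _) a = refl
χ-yes (no ¬a) a = contradiction a ¬a

χ-no : (a? : Dec A) → ¬ A → χ a? ≡ 0ℤ
χ-no (yes a) ¬a = contradiction a ¬a
χ-no (no _)  ¬a = refl

χ-≥0 : (a? : Dec A) → 0ℤ ≤ℤ χ a?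
χ-≥0 (yes _) = +≤+ ℕ.z≤n
χ-≥0 (no _)  = ℤ.≤-refl

χ-cong : (A → B) → (B → A) → (a? : Dec A) (b? : Dec B) → χ a? ≡ χ b?
χ-cong f g (yes a) b? = sym (χ-yes b? (f a))
χ-cong f g (no ¬a) b? = sym (χ-no b? (¬a ∘ g))

χ-× : (a? : Dec A) (b? : Dec B) → χ (a? ×-dec b?) ≡ χ a? * χ b?
χ-× (yes _) b? = sym (ℤ.*-identityˡ _)
χ-× (no _)  b? = refl

length-filter-χ : ∀ {P : A → Set} (P? : ∀ x → Dec (P x)) xs → + length (filter P? xs) ≡ ∑ xs (χ ∘ P?)
length-filter-χ P? []       = refl
length-filter-χ P? (x ∷ xs) with P? x
... | yes _ = +-congʳ 1ℤ (length-filter-χ P? xs)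
... | no  _ = trans (length-filter-χ P? xs) (sym (ℤ.+-identityˡ _))

module _ (_≟A_ : DecidableEquality A) where

  ∑-δ-∉ : ∀ {xs} (f : A → ℤ) {a} → All (a ≢_) xs → ∑ xs (λ x → χ (x ≟A a) * f x) ≡ 0ℤ
  ∑-δ-∉ f []           = refl
  ∑-δ-∉ {x ∷ xs} f {a} (a≢x ∷ a∉xs) = cong₂ _+_
    (cong (_* f x) (χ-no (x ≟A a) (a≢x ∘ sym))) (∑-δ-∉ f a∉xs)

  ∑-δ : ∀ {xs} → Unique xs → ∀ (f : A → ℤ) {a} → a ∈ xs → ∑ xs (λ x → χ (x ≟A a) * f x) ≡ f a
  ∑-δ {x ∷ xs} (x∉xs ∷ _) f (here refl) = begin
    χ (x ≟A x) * f x + ∑ xs (λ y → χ (y ≟A x) * f y)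
      ≡⟨ cong₂ (λ a b → a * f x + b) (χ-yes (x ≟A x) refl) (∑-δ-∉ f x∉xs) ⟩
    1ℤ * f x + 0ℤ
      ≡⟨ trans (ℤ.+-identityʳ _) (ℤ.*-identityˡ _) ⟩
    f x ∎
  ∑-δ {x ∷ xs} (x∉xs ∷ u) f {a} (there a∈xs) = begin
    χ (x ≟A a) * f x + ∑ xs (λ y → χ (y ≟A a) * f y)
      ≡⟨ cong₂ (λ c b → c * f x + b) (χ-no (x ≟A a) (All.lookup x∉xs a∈xs)) (∑-δ u f a∈xs) ⟩
    0ℤ + f a
      ≡⟨ ℤ.+-identityˡ _ ⟩
    f a ∎

  -- Both sides are double sums over the graph of `σ`: after exchanging the sums, the condition
  -- `y ≡ σ x` is read as `x ≡ τ y`.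
  ∑-reindex : ∀ {xs} → Unique xs → (∀ a → a ∈ xs) → (σ τ : A → A) →
    (∀ x → τ (σ x) ≡ x) → (∀ x → σ (τ x) ≡ x) → ∀ f → ∑ xs (f ∘ σ) ≡ ∑ xs f
  ∑-reindex {xs} u complete σ τ τσ στ f = begin
    ∑ xs (λ x → f (σ x))
      ≡⟨ ∑-cong xs (λ x → sym (∑-δ u f (complete (σ x)))) ⟩
    ∑ xs (λ x → ∑ xs (λ y → χ (y ≟A σ x) * f y))
      ≡⟨ ∑-swap xs xs _ ⟩
    ∑ xs (λ y → ∑ xs (λ x → χ (y ≟A σ x) * f y))
      ≡⟨ ∑-cong xs (λ y → ∑-cong xs λ x → cong (_* f y)
           (χ-cong (λ { refl → sym (τσ x) }) (λ { refl → sym (στ y) }) (y ≟A σ x) (x ≟A τ y))) ⟩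
    ∑ xs (λ y → ∑ xs (λ x → χ (x ≟A τ y) * f y))
      ≡⟨ ∑-cong xs (λ y → ∑-δ u (λ _ → f y) (complete (τ y))) ⟩
    ∑ xs f ∎

∑Fin-δ : ∀ (f : Fin k → ℤ) a → ∑ (allFin k) (λ x → χ (x ≟ a) * f x) ≡ f a
∑Fin-δ f a = ∑-δ _≟_ (allFin⁺ _) f (∈-allFin a)

∑Fin-δ′ : ∀ (f : Fin k → ℤ) a → ∑ (allFin k) (λ x → χ (a ≟ x) * f x) ≡ f a
∑Fin-δ′ f a = trans (∑-cong (allFin _) λ x → cong (_* f x) (χ-cong sym sym (a ≟ x) (x ≟ a))) (∑Fin-δ f a)

∑Fin-χ : ∀ (a : Fin k) → ∑ (allFin k) (λ x → χ (x ≟ a)) ≡ 1ℤ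
∑Fin-χ {k} a = trans (∑-cong (allFin k) λ x → sym (ℤ.*-identityʳ (χ (x ≟ a)))) (∑Fin-δ (λ _ → 1ℤ) a)

_≟ᵛ_ : DecidableEquality (Vec (Fin l) k)
_≟ᵛ_ = Vec.≡-dec _≟_

vecs-unique : ∀ {xs : List A} → Unique xs → ∀ m → Unique (vecs xs m)
vecs-unique u zero    = [] ∷ []
vecs-unique u (suc m) = cartesianProductWith⁺ _∷_ (λ { refl → refl , refl }) u (vecs-unique u m)

vecs-complete : ∀ {xs : List A} → (∀ a → a ∈ xs) → (v : Vec A k) → v ∈ vecs xs k
vecs-complete c []      = here refl
vecs-complete c (x ∷ v) = ∈-cartesianProductWith⁺ _∷_ (c x) (vecs-complete c v)

maps : ∀ p m → List (Vec (Fin p) m)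
maps p m = vecs (allFin p) m

maps-unique : ∀ p m → Unique (maps p m)
maps-unique p = vecs-unique (allFin⁺ p)

∈-maps : (v : Vec (Fin l) k) → v ∈ maps l k
∈-maps = vecs-complete ∈-allFin

∑-maps-suc : ∀ p m (f : Vec (Fin p) (suc m) → ℤ) →
  ∑ (maps p (suc m)) f ≡ ∑ (allFin p) (λ x → ∑ (maps p m) (λ v → f (x ∷ v)))
∑-maps-suc p m f = ∑-cartesianProductWith _∷_ (allFin p) (maps p m) f

-- Overwriting the entry at `v` forgets its old value, so every vector arises from exactly `p`
-- vectors.
∑-maps-update : ∀ {n} p (v : Fin n) (f : Vec (Fin p) n → ℤ) →
  ∑ (maps p n) (λ π → ∑ (allFin p) (λ x → f (π [ v ]≔ x))) ≡ + p * ∑ (maps p n) f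
∑-maps-update {suc n} p zero f = begin
  ∑ (maps p (suc n)) (λ π → ∑ (allFin p) (λ x → f (π [ zero ]≔ x)))
    ≡⟨ ∑-maps-suc p n _ ⟩
  ∑ (allFin p) (λ _ → ∑ (maps p n) (λ π → ∑ (allFin p) (λ x → f (x ∷ π))))
    ≡⟨ ∑-allFin-const p _ ⟩
  + p * ∑ (maps p n) (λ π → ∑ (allFin p) (λ x → f (x ∷ π)))
    ≡⟨ cong (+ p *_) (trans (∑-swap (maps p n) (allFin p) _) (sym (∑-maps-suc p n f))) ⟩
  + p * ∑ (maps p (suc n)) f ∎
∑-maps-update {suc n} p (suc v) f = begin
  ∑ (maps p (suc n)) (λ π → ∑ (allFin p) (λ x → f (π [ suc v ]≔ x)))
    ≡⟨ ∑-maps-suc p n _ ⟩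
  ∑ (allFin p) (λ y → ∑ (maps p n) (λ π → ∑ (allFin p) (λ x → f (y ∷ (π [ v ]≔ x)))))
    ≡⟨ ∑-cong (allFin p) (λ y → ∑-maps-update p v (f ∘ (y ∷_))) ⟩
  ∑ (allFin p) (λ y → + p * ∑ (maps p n) (f ∘ (y ∷_)))
    ≡⟨ ∑-*ˡ (allFin p) (+ p) _ ⟩
  + p * ∑ (allFin p) (λ y → ∑ (maps p n) (f ∘ (y ∷_)))
    ≡⟨ cong (+ p *_) (∑-maps-suc p n f) ⟨
  + p * ∑ (maps p (suc n)) f ∎

-- Congruence modulo p

module Modular (q : ℕ) where

  p : ℕ
  p = suc q

  infix 4 _≈_
  -- A record instead of a synonym for divisibility keeps both sides visible to unification.
  record _≈_ (a b : ℤ) : Set where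
    constructor congruent
    field difference : + p ∣ a - b
  open _≈_

  ≈-reflexive : ∀ {a b} → a ≡ b → a ≈ b
  ≈-reflexive {a} refl = congruent (divides 0ℤ (ℤ.+-inverseʳ a))

  ≈-refl : ∀ {a} → a ≈ a
  ≈-refl = ≈-reflexive refl

  ≈-sym : ∀ {a b} → a ≈ b → b ≈ a
  ≈-sym {a} {b} (congruent d) = congruent (subst (+ p ∣_) (eq a b) (∣m⇒∣-m d))
    where
    eq : ∀ a b → - (a - b) ≡ b - a
    eq = solve-∀

  ≈-trans : ∀ {a b c} → a ≈ b → b ≈ c → a ≈ c
  ≈-trans {a} {b} {c} (congruent d) (congruent d′) =
    congruent (subst (+ p ∣_) (eq a b c) (∣m∣n⇒∣m+n d d′))
    where
    eq : ∀ a b c → (a - b) + (b - c) ≡ a - c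
    eq = solve-∀

  ≈-+ : ∀ {a b c d} → a ≈ b → c ≈ d → a + c ≈ b + d
  ≈-+ {a} {b} {c} {d} (congruent d₁) (congruent d₂) =
    congruent (subst (+ p ∣_) (eq a b c d) (∣m∣n⇒∣m+n d₁ d₂))
    where
    eq : ∀ a b c d → (a - b) + (c - d) ≡ (a + c) - (b + d)
    eq = solve-∀

  ≈-*ˡ : ∀ c {a b} → a ≈ b → c * a ≈ c * b
  ≈-*ˡ c {a} {b} (congruent d) = congruent (subst (+ p ∣_) (eq c a b) (∣n⇒∣m*n c d))
    where
    eq : ∀ c a b → c * (a - b) ≡ c * a - c * b
    eq = solve-∀

  ≈-neg : ∀ {a b} → a ≈ b → - a ≈ - b
  ≈-neg {a} {b} (congruent d) = congruent (subst (+ p ∣_) (eq a b) (∣m⇒∣-m d))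
    where
    eq : ∀ a b → - (a - b) ≡ - a - - b
    eq = solve-∀

  ≈-- : ∀ {a b c d} → a ≈ b → c ≈ d → a - c ≈ b - d
  ≈-- a≈b c≈d = ≈-+ a≈b (≈-neg c≈d)

  ≈⇒-≈0 : ∀ {a b} → a ≈ b → a - b ≈ 0ℤ
  ≈⇒-≈0 {a} {b} (congruent d) = congruent (subst (+ p ∣_) (sym (ℤ.+-identityʳ (a - b))) d)

  -≈0⇒≈ : ∀ {a b} → a - b ≈ 0ℤ → a ≈ b
  -≈0⇒≈ {a} {b} (congruent d) = congruent (subst (+ p ∣_) (ℤ.+-identityʳ (a - b)) d)

  _≈?_ : ∀ a b → Dec (a ≈ b)
  a ≈? b = map′ congruent difference (+ p ∣? (a - b))

  -- The difference `b ∸ a` is a multiple of `p` smaller than `p`, hence zero.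
  ≤∧<∧≈⇒≥ : ∀ {a b} → a ℕ.≤ b → b ℕ.< p → + b ≈ + a → b ℕ.≤ a
  ≤∧<∧≈⇒≥ {a} {b} a≤b b<p (congruent d) with b ℕ.∸ a in eq
  ... | zero  = ℕ.m∸n≡0⇒m≤n eq
  ... | suc c = contradiction
    (ℕ.∣⇒≤ (subst (λ z → p ℕ.∣ ∣ z ∣) (trans (ℤ.m-n≡m⊖n b a) (trans (ℤ.⊖-≥ a≤b) (cong +_ eq))) (∣⇒∣ᵤ d)))
    (ℕ.<⇒≱ (ℕ.≤-<-trans (subst (ℕ._≤ b) eq (ℕ.m∸n≤m b a)) b<p))

  <∧≈⇒≡ : ∀ {a b} → a ℕ.< p → b ℕ.< p → + a ≈ + b → a ≡ b
  <∧≈⇒≡ {a} {b} a<p b<p a≈b with ℕ.≤-total a b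
  ... | inj₁ a≤b = ℕ.≤-antisym a≤b (≤∧<∧≈⇒≥ a≤b b<p (≈-sym a≈b))
  ... | inj₂ b≤a = ℕ.≤-antisym (≤∧<∧≈⇒≥ b≤a a<p a≈b) b≤a

  +*≈ : ∀ a b → a + b * + p ≈ a
  +*≈ a b = congruent (divides b (eq a (b * + p)))
    where
    eq : ∀ a c → (a + c) - a ≡ c
    eq = solve-∀

  %≈ : ∀ a → + (a ℕ.% p) ≈ + a
  %≈ a = ≈-sym (≈-trans (≈-reflexive (begin
    + a                                       ≡⟨ cong +_ (ℕ.m≡m%n+[m/n]*n a p) ⟩
    + (a ℕ.% p ℕ.+ a ℕ./ p ℕ.* p)             ≡⟨ ℤ.pos-+ (a ℕ.% p) _ ⟩
    + (a ℕ.% p) + + (a ℕ./ p ℕ.* p)           ≡⟨ +-congʳ (+ (a ℕ.% p)) (ℤ.pos-* (a ℕ./ p) p) ⟩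
    + (a ℕ.% p) + + (a ℕ./ p) * + p           ∎)) (+*≈ _ (+ (a ℕ./ p))))

  %≡⇒≈ : ∀ {a b} → a ℕ.% p ≡ b ℕ.% p → + a ≈ + b
  %≡⇒≈ {a} {b} eq = ≈-trans (≈-sym (%≈ a)) (≈-trans (≈-reflexive (cong +_ eq)) (%≈ b))

  ≈⇒%≡ : ∀ {a b} → + a ≈ + b → a ℕ.% p ≡ b ℕ.% p
  ≈⇒%≡ {a} {b} a≈b = <∧≈⇒≡ (ℕ.m%n<n a p) (ℕ.m%n<n b p) (≈-trans (%≈ a) (≈-trans a≈b (≈-sym (%≈ b))))

  ι : Fin p → ℤ
  ι x = + toℕ x

  red : ℤ → Fin p
  red z = fromℕ< (n%ℕd<d z p)

  ι-red : ∀ z → ι (red z) ≈ z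
  ι-red z = ≈-trans (≈-reflexive (cong +_ (toℕ-fromℕ< (n%ℕd<d z p))))
    (≈-sym (≈-trans (≈-reflexive (a≡a%ℕn+[a/ℕn]*n z p)) (+*≈ _ (z /ℕ p))))

  ι-injective : ∀ {x y} → ι x ≈ ι y → x ≡ y
  ι-injective {x} {y} x≈y = toℕ-injective (<∧≈⇒≡ (toℕ<n x) (toℕ<n y) x≈y)

  red-unique : ∀ {x z} → ι x ≈ z → x ≡ red z
  red-unique x≈z = ι-injective (≈-trans x≈z (≈-sym (ι-red _)))

  -- Counting nowhere-zero flows by deletion and contraction

  K : Fin p → Fin p → ℤ
  K x y = + p * χ (x ≟ y) - 1ℤ

  module _ {n m : ℕ} (t h : Fin m → Fin n) where

    imbalance : (Fin m → Fin p) → Fin n → ℤ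
    imbalance φ w = ∑ (allFin m) (λ e → (χ (h e ≟ w) - χ (t e ≟ w)) * ι (φ e))

    Flow : (Fin m → Fin p) → Set
    Flow φ = ∀ w → imbalance φ w ≈ 0ℤ

    flow? : ∀ φ → Dec (Flow φ)
    flow? φ = all? (λ w → imbalance φ w ≈? 0ℤ)

    #nzFlows : ℤ
    #nzFlows = ∑ (maps p m) (λ φ → ∏ (λ e → 1ℤ - χ (lookup φ e ≟ zero)) * χ (flow? (lookup φ)))

    -- This is F(0): the difference of a potential along an arc is zero exactly when its ends carry
    -- equal values. In this form deletion and contraction only alter `t` and `h`.
    potentialSum : ℤ
    potentialSum = ∑ (maps p n) (λ π → ∏ (λ e → K (lookup π (h e)) (lookup π (t e))))

  -- The vertex set stays `Fin n`. For `u ≢ v` the vertex `v` is left isolated and contributes a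
  -- free factor `p` to sums over potentials.
  contract : ∀ {n} → Fin n → Fin n → Fin n → Fin n
  contract u v y = if does (y ≟ v) then u else y

  -- Contraction appears as a correction linear in the indicator of `v`, so it can be summed over
  -- the arcs.
  χ-contract : ∀ {n} (u v w y : Fin n) →
    χ (contract u v y ≟ w) ≡ χ (y ≟ w) + (χ (u ≟ w) - χ (v ≟ w)) * χ (y ≟ v)
  χ-contract u v w y with y ≟ v
  ... | yes refl = eq (χ (u ≟ w)) (χ (v ≟ w))
    where
    eq : ∀ a b → a ≡ b + (a - b) * 1ℤ
    eq = solve-∀
  ... | no  _    = eq (χ (y ≟ w)) (χ (u ≟ w) - χ (v ≟ w))
    where
    eq : ∀ a b → a ≡ a + b * 0ℤ
    eq = solve-∀

  -- For `u ≢ v` the correction carries the imbalance at `v` over to `u` and leaves zero at `v`.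
  imbalance-contract : ∀ {n m} (t h : Fin m → Fin n) φ u v w →
    imbalance (contract u v ∘ t) (contract u v ∘ h) φ w
      ≡ imbalance t h φ w + (χ (u ≟ w) - χ (v ≟ w)) * imbalance t h φ v
  imbalance-contract {m = m} t h φ u v w = begin
    ∑ (allFin m) (λ e → (χ (contract u v (h e) ≟ w) - χ (contract u v (t e) ≟ w)) * ι (φ e))
      ≡⟨ ∑-cong (allFin m) (λ e → trans
           (cong₂ (λ a b → (a - b) * ι (φ e)) (χ-contract u v w (h e)) (χ-contract u v w (t e)))
           (eq (χ (h e ≟ w)) (χ (t e ≟ w)) (χ (h e ≟ v)) (χ (t e ≟ v)) c (ι (φ e)))) ⟩
    ∑ (allFin m) (λ e → (χ (h e ≟ w) - χ (t e ≟ w)) * ι (φ e) + c * ((χ (h e ≟ v) - χ (t e ≟ v)) * ι (φ e)))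
      ≡⟨ ∑-+ (allFin m) _ _ ⟩
    imbalance t h φ w + ∑ (allFin m) (λ e → c * ((χ (h e ≟ v) - χ (t e ≟ v)) * ι (φ e)))
      ≡⟨ +-congʳ (imbalance t h φ w) (∑-*ˡ (allFin m) c _) ⟩
    imbalance t h φ w + c * imbalance t h φ v ∎
    where
    c = χ (u ≟ w) - χ (v ≟ w)
    eq : ∀ a b a′ b′ c x →
      ((a + c * a′) - (b + c * b′)) * x ≡ (a - b) * x + c * ((a′ - b′) * x)
    eq = solve-∀

  module _ {n m : ℕ} (t h : Fin (suc m) → Fin n) where
    private
      u = t zero
      v = h zero
      t₀ = t ∘ suc
      h₀ = h ∘ suc
      t₁ = contract u v ∘ t₀
      h₁ = contract u v ∘ h₀

    imbalance-∷ : ∀ x (φ : Vec (Fin p) m) w → imbalance t h (lookup (x ∷ φ)) w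
      ≡ (χ (v ≟ w) - χ (u ≟ w)) * ι x + imbalance t₀ h₀ (lookup φ) w
    imbalance-∷ x φ w = ∑-allFin-suc m (λ e → (χ (h e ≟ w) - χ (t e ≟ w)) * ι (lookup (x ∷ φ) e))

    χ-flow-zero : ∀ φ → χ (flow? t h (lookup (zero ∷ φ))) ≡ χ (flow? t₀ h₀ (lookup φ))
    χ-flow-zero φ = χ-cong
      (λ f w → ≈-trans (≈-reflexive (sym (eq w))) (f w))
      (λ f w → ≈-trans (≈-reflexive (eq w)) (f w))
      (flow? t h (lookup (zero ∷ φ))) (flow? t₀ h₀ (lookup φ))
      where
      eq : ∀ w → imbalance t h (lookup (zero ∷ φ)) w ≡ imbalance t₀ h₀ (lookup φ) w
      eq w = trans (imbalance-∷ zero φ w)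
        (trans (cong (_+ imbalance t₀ h₀ (lookup φ) w) (ℤ.*-zeroʳ (χ (v ≟ w) - χ (u ≟ w)))) (ℤ.+-identityˡ _))

    χ-flow-loop : u ≡ v → ∀ x φ → χ (flow? t h (lookup (x ∷ φ))) ≡ χ (flow? t₀ h₀ (lookup φ))
    χ-flow-loop u≡v x φ = χ-cong
      (λ f w → ≈-trans (≈-reflexive (sym (eq w))) (f w))
      (λ f w → ≈-trans (≈-reflexive (eq w)) (f w))
      (flow? t h (lookup (x ∷ φ))) (flow? t₀ h₀ (lookup φ))
      where
      eq : ∀ w → imbalance t h (lookup (x ∷ φ)) w ≡ imbalance t₀ h₀ (lookup φ) w
      eq w = begin
        imbalance t h (lookup (x ∷ φ)) w
          ≡⟨ imbalance-∷ x φ w ⟩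
        (χ (v ≟ w) - χ (u ≟ w)) * ι x + imbalance t₀ h₀ (lookup φ) w
          ≡⟨ cong (λ z → (χ (v ≟ w) - χ (z ≟ w)) * ι x + imbalance t₀ h₀ (lookup φ) w) u≡v ⟩
        (χ (v ≟ w) - χ (v ≟ w)) * ι x + imbalance t₀ h₀ (lookup φ) w
          ≡⟨ cancel (χ (v ≟ w)) (ι x) _ ⟩
        imbalance t₀ h₀ (lookup φ) w ∎
        where
        cancel : ∀ a b c → (a - a) * b + c ≡ c
        cancel = solve-∀

    -- Conservation at the head determines the value on the contracted arc.
    χ-flow-contract : u ≢ v → ∀ x φ → χ (flow? t h (lookup (x ∷ φ)))
      ≡ χ (x ≟ red (- imbalance t₀ h₀ (lookup φ) v)) * χ (flow? t₁ h₁ (lookup φ))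
    χ-flow-contract u≢v x φ = trans
      (χ-cong to from (flow? t h (lookup (x ∷ φ))) ((x ≟ red (- b)) ×-dec flow? t₁ h₁ (lookup φ)))
      (χ-× (x ≟ red (- b)) (flow? t₁ h₁ (lookup φ)))
      where
      b = imbalance t₀ h₀ (lookup φ) v

      -- An arc from `u` to `v` with value `- b` contributes exactly the correction term of
      -- `imbalance-contract`.
      contracted : ι x ≈ - b → ∀ w → imbalance t h (lookup (x ∷ φ)) w ≈ imbalance t₁ h₁ (lookup φ) w
      contracted x≈-b w = ≈-trans (≈-reflexive (imbalance-∷ x φ w))
        (≈-trans (≈-+ (≈-*ˡ (χ (v ≟ w) - χ (u ≟ w)) x≈-b) ≈-refl)
          (≈-reflexive (trans (eq (χ (v ≟ w)) (χ (u ≟ w)) b _) (sym (imbalance-contract t₀ h₀ (lookup φ) u v w)))))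
        where
        eq : ∀ c d b i → (c - d) * - b + i ≡ i + (d - c) * b
        eq = solve-∀

      determined : Flow t h (lookup (x ∷ φ)) → ι x ≈ - b
      determined f = -≈0⇒≈ (≈-trans (≈-reflexive (sym eq)) (f v))
        where
        eq : imbalance t h (lookup (x ∷ φ)) v ≡ ι x - - b
        eq = begin
          imbalance t h (lookup (x ∷ φ)) v
            ≡⟨ imbalance-∷ x φ v ⟩
          (χ (v ≟ v) - χ (u ≟ v)) * ι x + b
            ≡⟨ cong₂ (λ c d → (c - d) * ι x + b) (χ-yes (v ≟ v) refl) (χ-no (u ≟ v) u≢v) ⟩
          1ℤ * ι x + b
            ≡⟨ cong₂ _+_ (ℤ.*-identityˡ (ι x)) (sym (ℤ.neg-involutive b)) ⟩
          ι x - - b ∎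

      to : Flow t h (lookup (x ∷ φ)) → x ≡ red (- b) × Flow t₁ h₁ (lookup φ)
      to f = red-unique (determined f) , λ w → ≈-trans (≈-sym (contracted (determined f) w)) (f w)

      from : x ≡ red (- b) × Flow t₁ h₁ (lookup φ) → Flow t h (lookup (x ∷ φ))
      from (refl , f) w = ≈-trans (contracted (ι-red (- b)) w) (f w)

    private
      Z : Vec (Fin p) m → ℤ
      Z φ = ∏ (λ e → 1ℤ - χ (lookup φ e ≟ zero))

      S : Vec (Fin p) m → ℤ
      S φ = ∑ (allFin p) (λ x → χ (flow? t h (lookup (x ∷ φ))))

    #nzFlows-∷ : #nzFlows t h ≡ ∑ (maps p m) (λ φ → Z φ * S φ) - #nzFlows t₀ h₀
    #nzFlows-∷ = begin
      #nzFlows t h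
        ≡⟨ ∑-maps-suc p m _ ⟩
      ∑ (allFin p) (λ x → ∑ (maps p m) (λ φ → (1ℤ - χ (x ≟ zero)) * Z φ * g x φ))
        ≡⟨ ∑-swap (allFin p) (maps p m) _ ⟩
      ∑ (maps p m) (λ φ → ∑ (allFin p) (λ x → (1ℤ - χ (x ≟ zero)) * Z φ * g x φ))
        ≡⟨ ∑-cong (maps p m) inner ⟩
      ∑ (maps p m) (λ φ → Z φ * S φ - Z φ * χ (flow? t₀ h₀ (lookup φ)))
        ≡⟨ ∑-minus (maps p m) _ _ ⟩
      ∑ (maps p m) (λ φ → Z φ * S φ) - #nzFlows t₀ h₀ ∎
      where
      g : Fin p → Vec (Fin p) m → ℤ
      g x φ = χ (flow? t h (lookup (x ∷ φ)))
      eq : ∀ c z g → (1ℤ - c) * z * g ≡ z * g - c * (z * g)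
      eq = solve-∀
      inner : ∀ φ → ∑ (allFin p) (λ x → (1ℤ - χ (x ≟ zero)) * Z φ * g x φ)
        ≡ Z φ * S φ - Z φ * χ (flow? t₀ h₀ (lookup φ))
      inner φ = begin
        ∑ (allFin p) (λ x → (1ℤ - χ (x ≟ zero)) * Z φ * g x φ)
          ≡⟨ ∑-cong (allFin p) (λ x → eq (χ (x ≟ zero)) (Z φ) (g x φ)) ⟩
        ∑ (allFin p) (λ x → Z φ * g x φ - χ (x ≟ zero) * (Z φ * g x φ))
          ≡⟨ ∑-minus (allFin p) (λ x → Z φ * g x φ) (λ x → χ (x ≟ zero) * (Z φ * g x φ)) ⟩
        ∑ (allFin p) (λ x → Z φ * g x φ) - ∑ (allFin p) (λ x → χ (x ≟ zero) * (Z φ * g x φ))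
          ≡⟨ cong₂ _-_ (∑-*ˡ (allFin p) (Z φ) _) (∑Fin-δ (λ x → Z φ * g x φ) zero) ⟩
        Z φ * S φ - Z φ * g zero φ
          ≡⟨ cong (λ z → Z φ * S φ - Z φ * z) (χ-flow-zero φ) ⟩
        Z φ * S φ - Z φ * χ (flow? t₀ h₀ (lookup φ)) ∎

    -- A loop does not affect conservation, so each of its `p` values is admissible in `S`.
    #nzFlows-loop : u ≡ v → #nzFlows t h ≡ (+ p - 1ℤ) * #nzFlows t₀ h₀
    #nzFlows-loop u≡v = begin
      #nzFlows t h
        ≡⟨ #nzFlows-∷ ⟩
      ∑ (maps p m) (λ φ → Z φ * S φ) - #nzFlows t₀ h₀
        ≡⟨ cong (_- #nzFlows t₀ h₀) (∑-cong (maps p m) inner) ⟩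
      ∑ (maps p m) (λ φ → + p * (Z φ * χ (flow? t₀ h₀ (lookup φ)))) - #nzFlows t₀ h₀
        ≡⟨ cong (_- #nzFlows t₀ h₀) (∑-*ˡ (maps p m) (+ p) _) ⟩
      + p * #nzFlows t₀ h₀ - #nzFlows t₀ h₀
        ≡⟨ eq (+ p) (#nzFlows t₀ h₀) ⟩
      (+ p - 1ℤ) * #nzFlows t₀ h₀ ∎
      where
      eq : ∀ a b → a * b - b ≡ (a - 1ℤ) * b
      eq = solve-∀
      comm : ∀ a b c → a * (b * c) ≡ b * (a * c)
      comm = solve-∀
      inner : ∀ φ → Z φ * S φ ≡ + p * (Z φ * χ (flow? t₀ h₀ (lookup φ)))
      inner φ = trans (cong (Z φ *_) (trans (∑-cong (allFin p) λ x → χ-flow-loop u≡v x φ) (∑-allFin-const p _)))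
        (comm (Z φ) (+ p) _)

    -- Each flow of the contraction extends by exactly one value on the first arc, so `S` becomes
    -- the indicator of such flows.
    #nzFlows-contract : u ≢ v → #nzFlows t h ≡ #nzFlows t₁ h₁ - #nzFlows t₀ h₀
    #nzFlows-contract u≢v = trans #nzFlows-∷ (cong (_- #nzFlows t₀ h₀) (∑-cong (maps p m) λ φ →
      cong (Z φ *_) (trans (∑-cong (allFin p) λ x → χ-flow-contract u≢v x φ)
        (∑Fin-δ (λ _ → χ (flow? t₁ h₁ (lookup φ))) (red (- imbalance t₀ h₀ (lookup φ) v))))))

    private
      R R₁ : Vec (Fin p) n → ℤ
      R  π = ∏ (λ e → K (lookup π (h₀ e)) (lookup π (t₀ e)))
      R₁ π = ∏ (λ e → K (lookup π (h₁ e)) (lookup π (t₁ e)))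

    potentialSum-loop : u ≡ v → potentialSum t h ≡ (+ p - 1ℤ) * potentialSum t₀ h₀
    potentialSum-loop u≡v = trans
      (∑-cong (maps p n) λ π → cong (_* R π) (trans
        (cong (λ c → + p * c - 1ℤ) (χ-yes (lookup π v ≟ lookup π u) (cong (lookup π) (sym u≡v))))
        (cong (_- 1ℤ) (ℤ.*-identityʳ (+ p)))))
      (∑-*ˡ (maps p n) (+ p - 1ℤ) R)

    lookup-contract : ∀ (π : Vec (Fin p) n) y → lookup (π [ v ]≔ lookup π u) y ≡ lookup π (contract u v y)
    lookup-contract π y with y ≟ v
    ... | yes refl = Vec.lookup∘update y π _
    ... | no  y≢v  = Vec.lookup∘update′ y≢v π _

    -- The factor `p` in `K` is absorbed by averaging over the value at `v`. The indicator forces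
    -- this value to be the one at `u`, and such a potential is what the contracted arcs see.
    potentialSum-contract : u ≢ v → potentialSum t h ≡ potentialSum t₁ h₁ - potentialSum t₀ h₀
    potentialSum-contract u≢v = begin
      ∑ (maps p n) (λ π → (+ p * c π - 1ℤ) * R π)
        ≡⟨ ∑-cong (maps p n) (λ π → eq (+ p) (c π) (R π)) ⟩
      ∑ (maps p n) (λ π → + p * (c π * R π) - R π)
        ≡⟨ ∑-minus (maps p n) _ R ⟩
      ∑ (maps p n) (λ π → + p * (c π * R π)) - potentialSum t₀ h₀
        ≡⟨ cong (_- potentialSum t₀ h₀) merge ⟩
      potentialSum t₁ h₁ - potentialSum t₀ h₀ ∎
      where
      c : Vec (Fin p) n → ℤ
      c π = χ (lookup π v ≟ lookup π u)
      eq : ∀ a b r → (a * b - 1ℤ) * r ≡ a * (b * r) - r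
      eq = solve-∀
      merge : ∑ (maps p n) (λ π → + p * (c π * R π)) ≡ potentialSum t₁ h₁
      merge = begin
        ∑ (maps p n) (λ π → + p * (c π * R π))
          ≡⟨ ∑-*ˡ (maps p n) (+ p) _ ⟩
        + p * ∑ (maps p n) (λ π → c π * R π)
          ≡⟨ ∑-maps-update p v (λ π → c π * R π) ⟨
        ∑ (maps p n) (λ π → ∑ (allFin p) (λ x → c (π [ v ]≔ x) * R (π [ v ]≔ x)))
          ≡⟨ ∑-cong (maps p n) (λ π → ∑-cong (allFin p) λ x → cong (_* R (π [ v ]≔ x))
               (cong₂ (λ a b → χ (a ≟ b)) (Vec.lookup∘update v π x) (Vec.lookup∘update′ u≢v π x))) ⟩
        ∑ (maps p n) (λ π → ∑ (allFin p) (λ x → χ (x ≟ lookup π u) * R (π [ v ]≔ x)))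
          ≡⟨ ∑-cong (maps p n) (λ π → ∑Fin-δ (λ x → R (π [ v ]≔ x)) (lookup π u)) ⟩
        ∑ (maps p n) (λ π → R (π [ v ]≔ lookup π u))
          ≡⟨ ∑-cong (maps p n) (λ π → ∏-cong λ e →
               cong₂ K (lookup-contract π (h₀ e)) (lookup-contract π (t₀ e))) ⟩
        ∑ (maps p n) R₁ ∎

  ∑-maps-one : ∀ n → ∑ (maps p n) (λ _ → 1ℤ) ≡ (+ p) ^ n
  ∑-maps-one zero    = refl
  ∑-maps-one (suc n) = trans (∑-maps-suc p n _) (trans (∑-allFin-const p _) (cong (+ p *_) (∑-maps-one n)))

  -- Both sides satisfy the same recursion for loops and for other arcs. Without arcs there are
  -- `p ^ n` potentials and one empty flow.
  potentialSum≡ : ∀ {n} m (t h : Fin m → Fin n) → potentialSum t h ≡ (+ p) ^ n * #nzFlows t h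
  potentialSum≡ {n} zero t h = begin
    ∑ (maps p n) (λ _ → 1ℤ)   ≡⟨ ∑-maps-one n ⟩
    (+ p) ^ n                   ≡⟨ ℤ.*-identityʳ _ ⟨
    (+ p) ^ n * 1ℤ              ≡⟨ cong ((+ p) ^ n *_) #nzFlows≡1 ⟨
    (+ p) ^ n * #nzFlows t h    ∎
    where
    #nzFlows≡1 : #nzFlows t h ≡ 1ℤ
    #nzFlows≡1 = trans (ℤ.+-identityʳ _) (trans (ℤ.*-identityˡ _)
      (χ-yes (flow? t h (lookup [])) (λ _ → ≈-refl)))
  potentialSum≡ {n} (suc m) t h with t zero ≟ h zero
  ... | yes u≡v = begin
    potentialSum t h
      ≡⟨ potentialSum-loop t h u≡v ⟩
    (+ p - 1ℤ) * potentialSum (t ∘ suc) (h ∘ suc)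
      ≡⟨ cong ((+ p - 1ℤ) *_) (potentialSum≡ m (t ∘ suc) (h ∘ suc)) ⟩
    (+ p - 1ℤ) * ((+ p) ^ n * #nzFlows (t ∘ suc) (h ∘ suc))
      ≡⟨ comm (+ p - 1ℤ) ((+ p) ^ n) _ ⟩
    (+ p) ^ n * ((+ p - 1ℤ) * #nzFlows (t ∘ suc) (h ∘ suc))
      ≡⟨ cong ((+ p) ^ n *_) (#nzFlows-loop t h u≡v) ⟨
    (+ p) ^ n * #nzFlows t h ∎
    where
    comm : ∀ a b c → a * (b * c) ≡ b * (a * c)
    comm = solve-∀
  ... | no u≢v = begin
    potentialSum t h
      ≡⟨ potentialSum-contract t h u≢v ⟩
    potentialSum t₁ h₁ - potentialSum (t ∘ suc) (h ∘ suc)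
      ≡⟨ cong₂ _-_ (potentialSum≡ m t₁ h₁) (potentialSum≡ m (t ∘ suc) (h ∘ suc)) ⟩
    (+ p) ^ n * #nzFlows t₁ h₁ - (+ p) ^ n * #nzFlows (t ∘ suc) (h ∘ suc)
      ≡⟨ distrib ((+ p) ^ n) _ _ ⟨
    (+ p) ^ n * (#nzFlows t₁ h₁ - #nzFlows (t ∘ suc) (h ∘ suc))
      ≡⟨ cong ((+ p) ^ n *_) (#nzFlows-contract t h u≢v) ⟨
    (+ p) ^ n * #nzFlows t h ∎
    where
    t₁ = contract (t zero) (h zero) ∘ t ∘ suc
    h₁ = contract (t zero) (h zero) ∘ h ∘ suc
    distrib : ∀ a b c → a * (b - c) ≡ a * b - a * c
    distrib = solve-∀

-- Vanishing, nonnegativity and parity signs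

lookup-ext : ∀ {A : Set} {k} {xs ys : Vec A k} → (∀ i → lookup xs i ≡ lookup ys i) → xs ≡ ys
lookup-ext {xs = xs} {ys} eq =
  trans (sym (Vec.tabulate∘lookup xs)) (trans (Vec.tabulate-cong eq) (Vec.tabulate∘lookup ys))

*-≢0 : ∀ {a b} → a ≢ 0ℤ → b ≢ 0ℤ → a * b ≢ 0ℤ
*-≢0 {a} a≢0 b≢0 ab≡0 = [ a≢0 , b≢0 ] (ℤ.i*j≡0⇒i≡0∨j≡0 a ab≡0)

*-≢0⁻ˡ : ∀ {a} b → a * b ≢ 0ℤ → a ≢ 0ℤ
*-≢0⁻ˡ b ab≢0 refl = ab≢0 refl

*-≢0⁻ʳ : ∀ a {b} → a * b ≢ 0ℤ → b ≢ 0ℤ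
*-≢0⁻ʳ a ab≢0 refl = ab≢0 (ℤ.*-zeroʳ a)

*-≥0 : ∀ {a b} → 0ℤ ≤ℤ a → 0ℤ ≤ℤ b → 0ℤ ≤ℤ a * b
*-≥0 {+ a} {+ b} _ _ = subst (0ℤ ≤ℤ_) (ℤ.pos-* a b) (+≤+ ℕ.z≤n)

square≥0 : ∀ a → 0ℤ ≤ℤ a * a
square≥0 (+ a)    = *-≥0 {+ a} {+ a} (+≤+ ℕ.z≤n) (+≤+ ℕ.z≤n)
square≥0 -[1+ a ] = +≤+ ℕ.z≤n

∏-≥0 : ∀ {k} {f : Fin k → ℤ} → (∀ e → 0ℤ ≤ℤ f e) → 0ℤ ≤ℤ ∏ f
∏-≥0 {zero}  f≥0 = +≤+ ℕ.z≤n
∏-≥0 {suc k} f≥0 = *-≥0 (f≥0 zero) (∏-≥0 (f≥0 ∘ suc))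

∏-≢0 : ∀ {k} (f : Fin k → ℤ) → ∏ f ≢ 0ℤ → ∀ e → f e ≢ 0ℤ
∏-≢0 f ∏≢0 zero    = *-≢0⁻ˡ (∏ (f ∘ suc)) ∏≢0
∏-≢0 f ∏≢0 (suc e) = ∏-≢0 (f ∘ suc) (*-≢0⁻ʳ (f zero) ∏≢0) e

χ-≢0 : ∀ {A : Set} (a? : Dec A) → χ a? ≢ 0ℤ → A
χ-≢0 (yes a) _  = a
χ-≢0 (no _)  ≢0 = contradiction refl ≢0

1-χ-≥0 : ∀ {A : Set} (a? : Dec A) → 0ℤ ≤ℤ 1ℤ - χ a?
1-χ-≥0 (yes _) = ℤ.≤-refl
1-χ-≥0 (no _)  = +≤+ ℕ.z≤n

-- This is the power of -1 with exponent `k`, written with the indicators of `IsEven` and `IsOdd` so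
-- that the two counts can be read off.
sign : ℕ → ℤ
sign k = χ (k ℕ.% 2 ℕ.≟ 0) - χ (k ℕ.% 2 ℕ.≟ 1)

sign-suc : ∀ k → sign (suc k) ≡ - sign k
sign-suc zero          = refl
sign-suc (suc zero)    = refl
sign-suc (suc (suc k)) = sign-suc k

-- The kernel K and the functions D

module Duality (q : ℕ) where
  open Modular q

  p^≢0 : ∀ k → (+ p) ^ k ≢ 0ℤ
  p^≢0 zero    = λ ()
  p^≢0 (suc k) = *-≢0 {+ p} (λ ()) (p^≢0 k)

  ∑-K : ∀ x (f : Fin p → ℤ) → ∑ (allFin p) (λ z → K x z * f z) ≡ + p * f x - ∑ (allFin p) f
  ∑-K x f = begin
    ∑ (allFin p) (λ z → K x z * f z)
      ≡⟨ ∑-cong (allFin p) (λ z → eq (+ p) (χ (x ≟ z)) (f z)) ⟩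
    ∑ (allFin p) (λ z → + p * (χ (x ≟ z) * f z) - f z)
      ≡⟨ ∑-minus (allFin p) (λ z → + p * (χ (x ≟ z) * f z)) f ⟩
    ∑ (allFin p) (λ z → + p * (χ (x ≟ z) * f z)) - ∑ (allFin p) f
      ≡⟨ cong (_- ∑ (allFin p) f) (trans (∑-*ˡ (allFin p) (+ p) (λ z → χ (x ≟ z) * f z)) (cong (+ p *_) (∑Fin-δ′ f x))) ⟩
    + p * f x - ∑ (allFin p) f ∎
    where
    eq : ∀ a c f → (a * c - 1ℤ) * f ≡ a * (c * f) - f
    eq = solve-∀

  K-sym : ∀ x y → K x y ≡ K y x
  K-sym x y = cong (λ c → + p * c - 1ℤ) (χ-cong sym sym (x ≟ y) (y ≟ x))

  ∑K≡0 : ∀ x → ∑ (allFin p) (K x) ≡ 0ℤ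
  ∑K≡0 x = begin
    ∑ (allFin p) (K x)                          ≡⟨ ∑-cong (allFin p) (λ z → ℤ.*-identityʳ (K x z)) ⟨
    ∑ (allFin p) (λ z → K x z * 1ℤ)             ≡⟨ ∑-K x (λ _ → 1ℤ) ⟩
    + p * 1ℤ - ∑ (allFin p) (λ _ → 1ℤ)          ≡⟨ cong (λ z → + p * 1ℤ - z) (∑-allFin-const p 1ℤ) ⟩
    + p * 1ℤ - + p * 1ℤ                         ≡⟨ ℤ.+-inverseʳ (+ p * 1ℤ) ⟩
    0ℤ                                          ∎

  -- The kernel acts as multiplication by `p` on functions of sum zero. Applied to a row of `K`,
  -- this is the identity K² = pK.
  ∑-K-balanced : ∀ x (f : Fin p → ℤ) → ∑ (allFin p) f ≡ 0ℤ → ∑ (allFin p) (λ z → K x z * f z) ≡ + p * f x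
  ∑-K-balanced x f ∑f≡0 = trans (∑-K x f) (trans (cong (λ z → + p * f x - z) ∑f≡0) (ℤ.+-identityʳ _))

  D : Fin q → Fin p → ℤ
  D a x = χ (x ≟ inject₁ a) - χ (x ≟ fromℕ q)

  ∑D≡0 : ∀ a → ∑ (allFin p) (D a) ≡ 0ℤ
  ∑D≡0 a = trans (∑-minus (allFin p) (λ x → χ (x ≟ inject₁ a)) (λ x → χ (x ≟ fromℕ q)))
    (cong₂ _-_ (∑Fin-χ (inject₁ a)) (∑Fin-χ (fromℕ q)))

  -- The functions D a form a basis of the functions with sum zero.
  ∑-D-balanced : ∀ (f : Fin p → ℤ) → ∑ (allFin p) f ≡ 0ℤ → ∀ x →
    ∑ (allFin q) (λ a → D a x * f (inject₁ a)) ≡ f x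
  ∑-D-balanced f ∑f≡0 x = begin
    ∑ (allFin q) (λ a → D a x * f (inject₁ a))
      ≡⟨ ℤ.+-identityʳ _ ⟨
    ∑ (allFin q) (λ a → D a x * f (inject₁ a)) + 0ℤ
      -- The coefficient at the top residue is zero, so that term may be added to extend the sum to
      -- all of `Fin p`.
      ≡⟨ +-congʳ (∑ (allFin q) (λ a → D a x * f (inject₁ a))) (cong (_* f (fromℕ q)) (ℤ.+-inverseʳ top)) ⟨
    ∑ (allFin q) (λ a → D a x * f (inject₁ a)) + (top - top) * f (fromℕ q)
      ≡⟨ ∑-allFin-last q (λ z → (χ (x ≟ z) - top) * f z) ⟨
    ∑ (allFin p) (λ z → (χ (x ≟ z) - top) * f z)
      ≡⟨ ∑-cong (allFin p) (λ z → eq (χ (x ≟ z)) top (f z)) ⟩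
    ∑ (allFin p) (λ z → χ (x ≟ z) * f z - top * f z)
      ≡⟨ ∑-minus (allFin p) (λ z → χ (x ≟ z) * f z) (λ z → top * f z) ⟩
    ∑ (allFin p) (λ z → χ (x ≟ z) * f z) - ∑ (allFin p) (λ z → top * f z)
      ≡⟨ cong₂ _-_ (∑Fin-δ′ f x) (∑-*ˡ (allFin p) top f) ⟩
    f x - top * ∑ (allFin p) f
      ≡⟨ cong (λ z → f x - top * z) ∑f≡0 ⟩
    f x - top * 0ℤ
      ≡⟨ cong (λ z → f x - z) (ℤ.*-zeroʳ top) ⟩
    f x - 0ℤ
      ≡⟨ ℤ.+-identityʳ (f x) ⟩
    f x ∎
    where
    top = χ (x ≟ fromℕ q)
    eq : ∀ a b c → (a - b) * c ≡ a * c - b * c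
    eq = solve-∀

  conformal? : ∀ {k} (ψ : Fin k → Fin q) (φ : Fin k → Fin p) → Dec (Conformal {p = p} ψ φ)
  conformal? ψ φ = all? (λ e → (toℕ (φ e) ℕ.≟ toℕ (ψ e)) ⊎-dec (toℕ (φ e) ℕ.≟ q))

  -- The values `a` and `q` are distinct because `a` is below `q`, so at most one indicator in `D`
  -- is nonzero. The decision is an argument so that it can be matched while occurring in the
  -- statement.
  D-sign : ∀ a x (top? : Dec (toℕ x ≡ q)) →
    D a x ≡ χ ((toℕ x ℕ.≟ toℕ a) ⊎-dec top?) * (if does top? then - 1ℤ else 1ℤ)
  D-sign a x (yes x≡q) = begin
    χ (x ≟ inject₁ a) - χ (x ≟ fromℕ q)
      ≡⟨ cong₂ _-_
           (χ-no (x ≟ inject₁ a) λ { refl → ℕ.<⇒≢ (toℕ<n a) (trans (sym (toℕ-inject₁ a)) x≡q) })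
           (χ-yes (x ≟ fromℕ q) (toℕ-injective (trans x≡q (sym (toℕ-fromℕ q))))) ⟩
    - 1ℤ
      ≡⟨ cong (_* - 1ℤ) (χ-yes ((toℕ x ℕ.≟ toℕ a) ⊎-dec yes x≡q) (inj₂ x≡q)) ⟨
    χ ((toℕ x ℕ.≟ toℕ a) ⊎-dec yes x≡q) * - 1ℤ ∎
  D-sign a x (no x≢q) = begin
    χ (x ≟ inject₁ a) - χ (x ≟ fromℕ q)
      ≡⟨ cong₂ _-_
           (χ-cong (λ { refl → inj₁ (toℕ-inject₁ a) })
             [ (λ x≡a → toℕ-injective (trans x≡a (sym (toℕ-inject₁ a)))) , (λ x≡q → contradiction x≡q x≢q) ]
             (x ≟ inject₁ a) ((toℕ x ℕ.≟ toℕ a) ⊎-dec no x≢q))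
           (χ-no (x ≟ fromℕ q) λ { refl → x≢q (toℕ-fromℕ q) }) ⟩
    χ ((toℕ x ℕ.≟ toℕ a) ⊎-dec no x≢q) - 0ℤ
      ≡⟨ trans (ℤ.+-identityʳ c) (sym (ℤ.*-identityʳ c)) ⟩
    c * 1ℤ ∎
    where c = χ ((toℕ x ℕ.≟ toℕ a) ⊎-dec no x≢q)

  -- A nonconformal arc gives the factor 0, an arc with value `p - 1` gives -1, and every other
  -- conformal arc gives 1.
  ∏-D : ∀ {k} (ψ : Fin k → Fin q) (φ : Fin k → Fin p) →
    ∏ (λ e → D (ψ e) (φ e)) ≡ χ (conformal? ψ φ) * sign (#top φ)
  ∏-D {zero}  ψ φ = refl
  ∏-D {suc k} ψ φ = begin
    D (ψ zero) (φ zero) * ∏ (λ e → D (ψ (suc e)) (φ (suc e)))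
      ≡⟨ cong₂ _*_ (D-sign (ψ zero) (φ zero) t₀) (∏-D (ψ ∘ suc) (φ ∘ suc)) ⟩
    (χ c₀ * (if does t₀ then - 1ℤ else 1ℤ)) * (χ c₁ * sign (#top (φ ∘ suc)))
      ≡⟨ *-interchange (χ c₀) (if does t₀ then - 1ℤ else 1ℤ) (χ c₁) (sign (#top (φ ∘ suc))) ⟩
    (χ c₀ * χ c₁) * ((if does t₀ then - 1ℤ else 1ℤ) * sign (#top (φ ∘ suc)))
      ≡⟨ cong₂ _*_ (trans (sym (χ-× c₀ c₁)) (χ-cong ∀-cons (λ c → c zero , c ∘ suc) (c₀ ×-dec c₁) (conformal? ψ φ)))
           (sign-step (does t₀) (#top (φ ∘ suc))) ⟩
    χ (conformal? ψ φ) * sign (#top φ) ∎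
    where
    t₀ = toℕ (φ zero) ℕ.≟ q
    c₀ = (toℕ (φ zero) ℕ.≟ toℕ (ψ zero)) ⊎-dec t₀
    c₁ = conformal? (ψ ∘ suc) (φ ∘ suc)
    ∀-cons : ∀ {P : Fin (suc k) → Set} → P zero × (∀ i → P (suc i)) → ∀ i → P i
    ∀-cons (p₀ , ps) zero    = p₀
    ∀-cons (p₀ , ps) (suc i) = ps i
    sign-step : ∀ b j → (if b then - 1ℤ else 1ℤ) * sign j ≡ sign ((if b then 1 else 0) ℕ.+ j)
    sign-step true  j = trans (ℤ.-1*i≡-i (sign j)) (sym (sign-suc j))
    sign-step false j = ℤ.*-identityˡ (sign j)

  -- Translation of potentials

  module _ {n m : ℕ} (t h : Fin m → Fin n) where

    -- All terms of the count are nonnegative and the one at `φ` is 1, so nothing can cancel it.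
    nzFlow⇒#nzFlows≢0 : ∀ (φ : Vec (Fin p) m) → Flow t h (lookup φ) → (∀ e → lookup φ e ≢ zero) → #nzFlows t h ≢ 0ℤ
    nzFlow⇒#nzFlows≢0 φ flow nz #≡0 = contradiction
      (trans (sym term≡1) (∑≡0⇒≡0 (maps p m) term (λ y → *-≥0 (∏-≥0 λ e → 1-χ-≥0 (lookup y e ≟ zero)) (χ-≥0 (flow? t h (lookup y)))) #≡0 (∈-maps φ)))
      λ ()
      where
      term : Vec (Fin p) m → ℤ
      term y = ∏ (λ e → 1ℤ - χ (lookup y e ≟ zero)) * χ (flow? t h (lookup y))
      term≡1 : term φ ≡ 1ℤ
      term≡1 = cong₂ _*_
        (trans (∏-cong λ e → cong (λ c → 1ℤ - c) (χ-no (lookup φ e ≟ zero) (nz e))) (trans (∏-const m 1ℤ) (ℤ.^-zeroˡ m)))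
        (χ-yes (flow? t h (lookup φ)) flow)

    #nzFlows≢0⇒nzFlow : #nzFlows t h ≢ 0ℤ → ∃ λ (φ : Vec (Fin p) m) → Flow t h (lookup φ) × (∀ e → lookup φ e ≢ zero)
    #nzFlows≢0⇒nzFlow #≢0 with ∑-≢0 (maps p m) _ #≢0
    ... | φ , term≢0 = φ , χ-≢0 (flow? t h (lookup φ)) (*-≢0⁻ʳ (∏ z) term≢0) ,
      λ e φe≡0 → ∏-≢0 z (*-≢0⁻ˡ (χ (flow? t h (lookup φ))) term≢0) e (cong (λ c → 1ℤ - c) (χ-yes (lookup φ e ≟ zero) φe≡0))
      where
      z : Fin m → ℤ
      z e = 1ℤ - χ (lookup φ e ≟ zero)

    δ : Vec (Fin p) n → Fin m → Fin p
    δ π e = red (ι (lookup π (h e)) - ι (lookup π (t e)))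

    _⊕_ _⊝_ : Vec (Fin p) n → Vec (Fin p) n → Vec (Fin p) n
    π ⊕ ρ = tabulate (λ v → red (ι (lookup π v) + ι (lookup ρ v)))
    π ⊝ ρ = tabulate (λ v → red (ι (lookup π v) - ι (lookup ρ v)))

    ⊕-≈ : ∀ π ρ v → ι (lookup (π ⊕ ρ) v) ≈ ι (lookup π v) + ι (lookup ρ v)
    ⊕-≈ π ρ v = ≈-trans (≈-reflexive (cong ι (Vec.lookup∘tabulate _ v))) (ι-red _)

    ⊝-≈ : ∀ π ρ v → ι (lookup (π ⊝ ρ) v) ≈ ι (lookup π v) - ι (lookup ρ v)
    ⊝-≈ π ρ v = ≈-trans (≈-reflexive (cong ι (Vec.lookup∘tabulate _ v))) (ι-red _)

    ⊕-⊝ : ∀ ρ π → (π ⊕ ρ) ⊝ ρ ≡ π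
    ⊕-⊝ ρ π = lookup-ext λ v → ι-injective (≈-trans (⊝-≈ (π ⊕ ρ) ρ v)
      (≈-trans (≈-- (⊕-≈ π ρ v) (≈-refl {ι (lookup ρ v)})) (≈-reflexive (eq (ι (lookup π v)) (ι (lookup ρ v))))))
      where
      eq : ∀ a b → (a + b) - b ≡ a
      eq = solve-∀

    ⊝-⊕ : ∀ ρ π → (π ⊝ ρ) ⊕ ρ ≡ π
    ⊝-⊕ ρ π = lookup-ext λ v → ι-injective (≈-trans (⊕-≈ (π ⊝ ρ) ρ v)
      (≈-trans (≈-+ (⊝-≈ π ρ v) (≈-refl {ι (lookup ρ v)})) (≈-reflexive (eq (ι (lookup π v)) (ι (lookup ρ v))))))
      where
      eq : ∀ a b → (a - b) + b ≡ a
      eq = solve-∀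

    ∑-translate : ∀ ρ (f : Vec (Fin p) n → ℤ) → ∑ (maps p n) (λ π → f (π ⊕ ρ)) ≡ ∑ (maps p n) f
    ∑-translate ρ f = ∑-reindex _≟ᵛ_ (maps-unique p n) ∈-maps (_⊕ ρ) (_⊝ ρ) (⊕-⊝ ρ) (⊝-⊕ ρ) f

    δ-⊕ : ∀ π ρ e → ι (δ (π ⊕ ρ) e) ≈ (ι (lookup π (h e)) - ι (lookup π (t e))) + ι (δ ρ e)
    δ-⊕ π ρ e = ≈-trans (ι-red _) (≈-trans (≈-- (⊕-≈ π ρ (h e)) (⊕-≈ π ρ (t e)))
      (≈-trans (≈-reflexive (eq (ι (lookup π (h e))) (ι (lookup ρ (h e))) (ι (lookup π (t e))) (ι (lookup ρ (t e)))))
        (≈-+ (≈-refl {ι (lookup π (h e)) - ι (lookup π (t e))}) (≈-sym (ι-red (ι (lookup ρ (h e)) - ι (lookup ρ (t e))))))))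
      where
      eq : ∀ a b c d → (a + b) - (c + d) ≡ (a - c) + (b - d)
      eq = solve-∀

    -- By additivity of `δ`, adding `π` leaves the value on `e` unchanged only if `π` has difference
    -- zero along `e`.
    δ-⊕-fixed⇒ : ∀ π ρ e → δ (π ⊕ ρ) e ≡ δ ρ e → lookup π (h e) ≡ lookup π (t e)
    δ-⊕-fixed⇒ π ρ e fixed = ι-injective (-≈0⇒≈ (≈-trans (≈-reflexive (sym (eq (ι (lookup π (h e)) - ι (lookup π (t e))) (ι (δ ρ e)))))
      (≈⇒-≈0 (≈-trans (≈-sym (δ-⊕ π ρ e)) (≈-reflexive (cong ι fixed))))))
      where
      eq : ∀ a b → (a + b) - b ≡ a
      eq = solve-∀

    δ-⊕-fixed⇐ : ∀ π ρ e → lookup π (h e) ≡ lookup π (t e) → δ (π ⊕ ρ) e ≡ δ ρ e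
    δ-⊕-fixed⇐ π ρ e eq = ι-injective (≈-trans (δ-⊕ π ρ e) (≈-trans (≈-+ (≈⇒-≈0 (≈-reflexive (cong ι eq))) ≈-refl)
      (≈-reflexive (ℤ.+-identityˡ (ι (δ ρ e))))))

    -- The transform F and the signed sums

    F : (Fin m → Fin p) → ℤ
    F y = ∑ (maps p n) (λ π → ∏ (λ e → K (δ π e) (y e)))

    -- Translating the summation variable by `ρ` turns agreement of `δ π` with `δ ρ` into agreement
    -- of `π` at the two ends of the arc.
    F-δ : ∀ ρ → F (δ ρ) ≡ potentialSum t h
    F-δ ρ = trans (sym (∑-translate ρ (λ π → ∏ (λ e → K (δ π e) (δ ρ e)))))
      (∑-cong (maps p n) λ π → ∏-cong λ e → cong (λ c → + p * c - 1ℤ)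
        (χ-cong (δ-⊕-fixed⇒ π ρ e) (δ-⊕-fixed⇐ π ρ e) (δ (π ⊕ ρ) e ≟ δ ρ e) (lookup π (h e) ≟ lookup π (t e))))

    -- A Parseval identity. The square is a sum over pairs of potentials; for a fixed pair the sum
    -- over `y` factors over the arcs, and K² = pK evaluates each factor. What remains is a sum of
    -- values `F (δ ρ)`, all equal by `F-δ`.
    ∑-F² : ∑ (maps p m) (λ y → F (lookup y) * F (lookup y)) ≡ (+ p) ^ m * ((+ p) ^ n * potentialSum t h)
    ∑-F² = begin
      ∑ Y (λ y → F (lookup y) * F (lookup y))
        ≡⟨ ∑-cong Y (λ y → sym (∑-*ˡ Π (F (lookup y)) (λ ρ → κ ρ (lookup y)))) ⟩
      ∑ Y (λ y → ∑ Π (λ ρ → F (lookup y) * κ ρ (lookup y)))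
        ≡⟨ ∑-cong Y (λ y → ∑-cong Π λ ρ → sym (∑-*ʳ Π (κ ρ (lookup y)) (λ π → κ π (lookup y)))) ⟩
      ∑ Y (λ y → ∑ Π (λ ρ → ∑ Π (λ π → κ π (lookup y) * κ ρ (lookup y))))
        ≡⟨ ∑-swap Y Π (λ y ρ → ∑ Π (λ π → κ π (lookup y) * κ ρ (lookup y))) ⟩
      ∑ Π (λ ρ → ∑ Y (λ y → ∑ Π (λ π → κ π (lookup y) * κ ρ (lookup y))))
        ≡⟨ ∑-cong Π (λ ρ → ∑-swap Y Π (λ y π → κ π (lookup y) * κ ρ (lookup y))) ⟩
      ∑ Π (λ ρ → ∑ Π (λ π → ∑ Y (λ y → κ π (lookup y) * κ ρ (lookup y))))
        ≡⟨ ∑-cong Π (λ ρ → ∑-cong Π λ π → orthogonality π ρ) ⟩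
      ∑ Π (λ ρ → ∑ Π (λ π → (+ p) ^ m * κ π (δ ρ)))
        ≡⟨ ∑-cong Π (λ ρ → trans (∑-*ˡ Π ((+ p) ^ m) (λ π → κ π (δ ρ))) (cong ((+ p) ^ m *_) (F-δ ρ))) ⟩
      ∑ Π (λ _ → (+ p) ^ m * potentialSum t h)
        ≡⟨ ∑-*ˡ Π ((+ p) ^ m) (λ _ → potentialSum t h) ⟩
      (+ p) ^ m * ∑ Π (λ _ → potentialSum t h)
        ≡⟨ cong ((+ p) ^ m *_) (trans (∑-cong Π (λ _ → sym (ℤ.*-identityˡ (potentialSum t h))))
             (trans (∑-*ʳ Π (potentialSum t h) (λ _ → 1ℤ)) (cong (_* potentialSum t h) (∑-maps-one n)))) ⟩
      (+ p) ^ m * ((+ p) ^ n * potentialSum t h) ∎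
      where
      Y = maps p m
      Π = maps p n
      κ : Vec (Fin p) n → (Fin m → Fin p) → ℤ
      κ π y = ∏ (λ e → K (δ π e) (y e))
      orthogonality : ∀ π ρ → ∑ Y (λ y → κ π (lookup y) * κ ρ (lookup y)) ≡ (+ p) ^ m * κ π (δ ρ)
      orthogonality π ρ = begin
        ∑ Y (λ y → κ π (lookup y) * κ ρ (lookup y))
          ≡⟨ ∑-cong Y (λ y → ∏-* (λ e → K (δ π e) (lookup y e)) (λ e → K (δ ρ e) (lookup y e))) ⟨
        ∑ Y (λ y → ∏ (λ e → K (δ π e) (lookup y e) * K (δ ρ e) (lookup y e)))
          ≡⟨ ∏-∑ m (allFin p) (λ e x → K (δ π e) x * K (δ ρ e) x) ⟨
        ∏ (λ e → ∑ (allFin p) (λ x → K (δ π e) x * K (δ ρ e) x))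
          ≡⟨ ∏-cong (λ e → trans (∑-K-balanced (δ π e) (K (δ ρ e)) (∑K≡0 (δ ρ e))) (cong (+ p *_) (K-sym (δ ρ e) (δ π e)))) ⟩
        ∏ (λ e → + p * K (δ π e) (δ ρ e))
          ≡⟨ ∏-* (λ _ → + p) (λ e → K (δ π e) (δ ρ e)) ⟩
        ∏ {m} (λ _ → + p) * κ π (δ ρ)
          ≡⟨ cong (_* κ π (δ ρ)) (∏-const m (+ p)) ⟩
        (+ p) ^ m * κ π (δ ρ) ∎

    F≢0⇒potentialSum≢0 : ∀ (y : Vec (Fin p) m) → F (lookup y) ≢ 0ℤ → potentialSum t h ≢ 0ℤ
    F≢0⇒potentialSum≢0 y Fy≢0 P≡0 = *-≢0 Fy≢0 Fy≢0
      (∑≡0⇒≡0 (maps p m) (λ y → F (lookup y) * F (lookup y)) (λ y → square≥0 (F (lookup y))) ∑≡0 (∈-maps y))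
      where
      ∑≡0 : ∑ (maps p m) (λ y → F (lookup y) * F (lookup y)) ≡ 0ℤ
      ∑≡0 = trans ∑-F² (trans (cong (λ P → (+ p) ^ m * ((+ p) ^ n * P)) P≡0)
        (trans (cong ((+ p) ^ m *_) (ℤ.*-zeroʳ ((+ p) ^ n))) (ℤ.*-zeroʳ ((+ p) ^ m))))

    signedSum : (Fin m → Fin q) → ℤ
    signedSum ψ = ∑ (maps p n) (λ π → ∏ (λ e → D (ψ e) (δ π e)))

    -- Every row of `K` sums to zero and so expands in the functions `D a`. Distributing over the
    -- arcs makes one choice `ψ` per term.
    F≡∑-signedSum : ∀ y → F y ≡ ∑ (maps q m) (λ ψ → signedSum (lookup ψ) * ∏ (λ e → K (inject₁ (lookup ψ e)) (y e)))
    F≡∑-signedSum y = begin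
      ∑ Π (λ π → ∏ (λ e → K (δ π e) (y e)))
        ≡⟨ ∑-cong Π (λ π → ∏-cong λ e → sym (∑-D-balanced (λ x → K x (y e))
             (trans (∑-cong (allFin p) λ x → K-sym x (y e)) (∑K≡0 (y e))) (δ π e))) ⟩
      ∑ Π (λ π → ∏ (λ e → ∑ (allFin q) (λ a → D a (δ π e) * K (inject₁ a) (y e))))
        ≡⟨ ∑-cong Π (λ π → ∏-∑ m (allFin q) (λ e a → D a (δ π e) * K (inject₁ a) (y e))) ⟩
      ∑ Π (λ π → ∑ Ψ (λ ψ → ∏ (λ e → D (lookup ψ e) (δ π e) * K (inject₁ (lookup ψ e)) (y e))))
        ≡⟨ ∑-swap Π Ψ (λ π ψ → ∏ (λ e → D (lookup ψ e) (δ π e) * K (inject₁ (lookup ψ e)) (y e))) ⟩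
      ∑ Ψ (λ ψ → ∑ Π (λ π → ∏ (λ e → D (lookup ψ e) (δ π e) * K (inject₁ (lookup ψ e)) (y e))))
        ≡⟨ ∑-cong Ψ (λ ψ → ∑-cong Π λ π → ∏-* (λ e → D (lookup ψ e) (δ π e)) (λ e → K (inject₁ (lookup ψ e)) (y e))) ⟩
      ∑ Ψ (λ ψ → ∑ Π (λ π → ∏ (λ e → D (lookup ψ e) (δ π e)) * ∏ (λ e → K (inject₁ (lookup ψ e)) (y e))))
        ≡⟨ ∑-cong Ψ (λ ψ → ∑-*ʳ Π (∏ (λ e → K (inject₁ (lookup ψ e)) (y e))) (λ π → ∏ (λ e → D (lookup ψ e) (δ π e)))) ⟩
      ∑ Ψ (λ ψ → signedSum (lookup ψ) * ∏ (λ e → K (inject₁ (lookup ψ e)) (y e))) ∎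
      where
      Π = maps p n
      Ψ = maps q m

    -- Each `D (ψ e)` sums to zero and is reproduced by `K` up to a factor `p`. One such factor per
    -- arc accounts for `p ^ m`.
    signedSum≡∑-F : ∀ ψ → (+ p) ^ m * signedSum ψ ≡ ∑ (maps p m) (λ y → F (lookup y) * ∏ (λ e → D (ψ e) (lookup y e)))
    signedSum≡∑-F ψ = begin
      (+ p) ^ m * signedSum ψ
        ≡⟨ ∑-*ˡ Π ((+ p) ^ m) (λ π → ∏ (λ e → D (ψ e) (δ π e))) ⟨
      ∑ Π (λ π → (+ p) ^ m * ∏ (λ e → D (ψ e) (δ π e)))
        ≡⟨ ∑-cong Π (λ π → trans (cong (_* ∏ (λ e → D (ψ e) (δ π e))) (sym (∏-const m (+ p))))
             (sym (∏-* (λ _ → + p) (λ e → D (ψ e) (δ π e))))) ⟩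
      ∑ Π (λ π → ∏ (λ e → + p * D (ψ e) (δ π e)))
        ≡⟨ ∑-cong Π (λ π → ∏-cong λ e → sym (∑-K-balanced (δ π e) (D (ψ e)) (∑D≡0 (ψ e)))) ⟩
      ∑ Π (λ π → ∏ (λ e → ∑ (allFin p) (λ x → K (δ π e) x * D (ψ e) x)))
        ≡⟨ ∑-cong Π (λ π → ∏-∑ m (allFin p) (λ e x → K (δ π e) x * D (ψ e) x)) ⟩
      ∑ Π (λ π → ∑ Y (λ y → ∏ (λ e → K (δ π e) (lookup y e) * D (ψ e) (lookup y e))))
        ≡⟨ ∑-swap Π Y (λ π y → ∏ (λ e → K (δ π e) (lookup y e) * D (ψ e) (lookup y e))) ⟩
      ∑ Y (λ y → ∑ Π (λ π → ∏ (λ e → K (δ π e) (lookup y e) * D (ψ e) (lookup y e))))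
        ≡⟨ ∑-cong Y (λ y → ∑-cong Π λ π → ∏-* (λ e → K (δ π e) (lookup y e)) (λ e → D (ψ e) (lookup y e))) ⟩
      ∑ Y (λ y → ∑ Π (λ π → ∏ (λ e → K (δ π e) (lookup y e)) * ∏ (λ e → D (ψ e) (lookup y e))))
        ≡⟨ ∑-cong Y (λ y → ∑-*ʳ Π (∏ (λ e → D (ψ e) (lookup y e))) (λ π → ∏ (λ e → K (δ π e) (lookup y e)))) ⟩
      ∑ Y (λ y → F (lookup y) * ∏ (λ e → D (ψ e) (lookup y e))) ∎
      where
      Π = maps p n
      Y = maps p m

    potentialSum≢0⇒signedSum≢0 : potentialSum t h ≢ 0ℤ → ∃ λ (ψ : Vec (Fin q) m) → signedSum (lookup ψ) ≢ 0ℤ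
    potentialSum≢0⇒signedSum≢0 P≢0 =
      let ψ , ≢0 = ∑-≢0 (maps q m) (λ ψ → signedSum (lookup ψ) * κ ψ)
            (λ ∑≡0 → P≢0 (trans (sym (F-δ π₀)) (trans (F≡∑-signedSum (δ π₀)) ∑≡0)))
      in ψ , *-≢0⁻ˡ {signedSum (lookup ψ)} (κ ψ) ≢0
      where
      -- The zero potential supplies a tension at which `F` equals `potentialSum`.
      π₀ : Vec (Fin p) n
      π₀ = replicate n zero
      κ : Vec (Fin q) m → ℤ
      κ ψ = ∏ (λ e → K (inject₁ (lookup ψ e)) (δ π₀ e))

    signedSum≢0⇒potentialSum≢0 : ∀ ψ → signedSum ψ ≢ 0ℤ → potentialSum t h ≢ 0ℤ
    signedSum≢0⇒potentialSum≢0 ψ S≢0 =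
      let y , ≢0 = ∑-≢0 (maps p m) (λ y → F (lookup y) * κ y)
            (λ ∑≡0 → *-≢0 (p^≢0 m) S≢0 (trans (signedSum≡∑-F ψ) ∑≡0))
      in F≢0⇒potentialSum≢0 y (*-≢0⁻ˡ {F (lookup y)} (κ y) ≢0)
      where
      κ : Vec (Fin p) m → ℤ
      κ y = ∏ (λ e → D (ψ e) (lookup y e))

    -- Tensions and the number of their potentials

    Tension : (Fin m → Fin p) → Set
    Tension φ = ∃ λ π → ∀ e → φ e ≡ δ π e

    tension? : ∀ φ → Dec (Tension φ)
    tension? φ = map′ (λ any → let π , _ , eq = find any in π , eq) (λ (π , eq) → lose (∈-maps π) eq)
      (any? (λ π → all? (λ e → φ e ≟ δ π e)) (maps p n))

    constant? : ∀ (π : Vec (Fin p) n) → Dec (∀ e → lookup π (h e) ≡ lookup π (t e))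
    constant? π = all? (λ e → lookup π (h e) ≟ lookup π (t e))

    -- Counts the potentials constant on each connected component; these are the potentials of the
    -- zero tension.
    #constant : ℤ
    #constant = ∑ (maps p n) (χ ∘ constant?)

    #constant≢0 : #constant ≢ 0ℤ
    #constant≢0 #≡0 = contradiction
      (trans (sym (χ-yes (constant? π₀) λ e → trans (Vec.lookup-replicate (h e) zero) (sym (Vec.lookup-replicate (t e) zero))))
        (∑≡0⇒≡0 (maps p n) (χ ∘ constant?) (χ-≥0 ∘ constant?) #≡0 (∈-maps π₀)))
      λ ()
      where
      π₀ : Vec (Fin p) n
      π₀ = replicate n zero

    -- The potentials of a tension form a coset of those of the zero tension.
    #potentials : ∀ (φ : Vec (Fin p) m) (φ? : Dec (Tension (lookup φ))) →
      ∑ (maps p n) (λ π → χ (φ ≟ᵛ tabulate (δ π))) ≡ χ φ? * #constant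
    #potentials φ (yes (ρ , φ≡δρ)) = begin
      ∑ (maps p n) (λ π → χ (φ ≟ᵛ tabulate (δ π)))
        ≡⟨ ∑-translate ρ (λ π → χ (φ ≟ᵛ tabulate (δ π))) ⟨
      ∑ (maps p n) (λ π → χ (φ ≟ᵛ tabulate (δ (π ⊕ ρ))))
        ≡⟨ ∑-cong (maps p n) (λ π → χ-cong
             (λ eq e → δ-⊕-fixed⇒ π ρ e (trans (sym (trans (cong (λ v → lookup v e) eq) (Vec.lookup∘tabulate (δ (π ⊕ ρ)) e))) (φ≡δρ e)))
             (λ const → lookup-ext λ e → trans (φ≡δρ e) (sym (trans (Vec.lookup∘tabulate (δ (π ⊕ ρ)) e) (δ-⊕-fixed⇐ π ρ e (const e)))))
             (φ ≟ᵛ tabulate (δ (π ⊕ ρ))) (constant? π)) ⟩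
      #constant
        ≡⟨ ℤ.*-identityˡ #constant ⟨
      1ℤ * #constant ∎
    #potentials φ (no ¬tension) = trans
      (∑-cong (maps p n) λ π → χ-no (φ ≟ᵛ tabulate (δ π)) λ eq →
        ¬tension (π , λ e → trans (cong (λ v → lookup v e) eq) (Vec.lookup∘tabulate (δ π) e)))
      (∑-zero (maps p n))

    -- The summand depends on `π` only through its tension. Grouping the potentials by tension
    -- yields groups of common size `#constant`.
    signedSum≡ : ∀ ψ → signedSum ψ ≡
      ∑ (maps p m) (λ φ → χ (tension? (lookup φ)) * (χ (conformal? ψ (lookup φ)) * sign (#top (lookup φ)))) * #constant
    signedSum≡ ψ = begin
      ∑ Π (λ π → ∏ (λ e → D (ψ e) (δ π e)))
        ≡⟨ ∑-cong Π (λ π → ∏-cong λ e → cong (D (ψ e)) (sym (Vec.lookup∘tabulate (δ π) e))) ⟩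
      ∑ Π (λ π → g (tabulate (δ π)))
        ≡⟨ ∑-cong Π (λ π → sym (∑-δ _≟ᵛ_ (maps-unique p m) g (∈-maps (tabulate (δ π))))) ⟩
      ∑ Π (λ π → ∑ Y (λ φ → χ (φ ≟ᵛ tabulate (δ π)) * g φ))
        ≡⟨ ∑-swap Π Y (λ π φ → χ (φ ≟ᵛ tabulate (δ π)) * g φ) ⟩
      ∑ Y (λ φ → ∑ Π (λ π → χ (φ ≟ᵛ tabulate (δ π)) * g φ))
        ≡⟨ ∑-cong Y (λ φ → trans (∑-*ʳ Π (g φ) (λ π → χ (φ ≟ᵛ tabulate (δ π))))
             (trans (cong (_* g φ) (#potentials φ (tension? (lookup φ)))) (comm (χ (tension? (lookup φ))) #constant (g φ)))) ⟩
      ∑ Y (λ φ → χ (tension? (lookup φ)) * g φ * #constant)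
        ≡⟨ ∑-*ʳ Y #constant (λ φ → χ (tension? (lookup φ)) * g φ) ⟩
      ∑ Y (λ φ → χ (tension? (lookup φ)) * g φ) * #constant
        ≡⟨ cong (_* #constant) (∑-cong Y λ φ → cong (χ (tension? (lookup φ)) *_) (∏-D ψ (lookup φ))) ⟩
      ∑ Y (λ φ → χ (tension? (lookup φ)) * (χ (conformal? ψ (lookup φ)) * sign (#top (lookup φ)))) * #constant ∎
      where
      Π = maps p n
      Y = maps p m
      g : Vec (Fin p) m → ℤ
      g φ = ∏ (λ e → D (ψ e) (lookup φ e))
      comm : ∀ a b c → a * b * c ≡ a * c * b
      comm = solve-∀

-- Dual flows and potentials

next-inject₁ : ∀ {k} (i : Fin k) → next (inject₁ i) ≡ suc i
next-inject₁ {k} i = toℕ-injective (trans (toℕ-fromℕ< _) (trans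
  (ℕ.m<n⇒m%n≡m (ℕ.s≤s (subst (ℕ._< k) (sym (toℕ-inject₁ i)) (toℕ<n i)))) (cong suc (toℕ-inject₁ i))))

next-fromℕ : ∀ k → next (fromℕ k) ≡ zero
next-fromℕ k = toℕ-injective (trans (toℕ-fromℕ< _)
  (trans (cong (λ j → suc j ℕ.% suc k) (toℕ-fromℕ k)) (ℕ.n%n≡0 (suc k))))

-- The cyclic shift only moves the first term to the end.
∑-next : ∀ k (f : Fin k → ℤ) → ∑ (allFin k) (f ∘ next) ≡ ∑ (allFin k) f
∑-next zero    f = refl
∑-next (suc k) f = begin
  ∑ (allFin (suc k)) (f ∘ next)
    ≡⟨ ∑-allFin-last k (f ∘ next) ⟩
  ∑ (allFin k) (f ∘ next ∘ inject₁) + f (next (fromℕ k))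
    ≡⟨ cong₂ _+_ (∑-cong (allFin k) (λ i → cong f (next-inject₁ i))) (cong f (next-fromℕ k)) ⟩
  ∑ (allFin k) (f ∘ suc) + f zero
    ≡⟨ ℤ.+-comm _ (f zero) ⟩
  f zero + ∑ (allFin k) (f ∘ suc)
    ≡⟨ ∑-allFin-suc k f ⟨
  ∑ (allFin (suc k)) f ∎

pos-Σ : ∀ k (f : Fin k → ℕ) → + Σ[<] k f ≡ ∑ (allFin k) (λ i → + f i)
pos-Σ zero    f = refl
pos-Σ (suc k) f = trans (ℤ.pos-+ (f zero) (Σ[<] k (f ∘ suc)))
  (trans (+-congʳ (+ f zero) (pos-Σ k (f ∘ suc))) (sym (∑-allFin-suc k (λ i → + f i))))

signed : Bool → ℤ → ℤ
signed true  x = x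
signed false x = - x

module Tensions (q : ℕ) (G : Digraph) where
  open Modular q
  open Duality q

  private
    V = Fin (n G)
    E = Fin (m G)

  -- Unfolds to the condition on a step of a `Circuit`, with the ends as arguments.
  Joins : Bool → E → V → V → Set
  Joins b e u v = if b then (tail G e ≡ u × head G e ≡ v) else (head G e ≡ u × tail G e ≡ v)

  Joins-sym : ∀ b {e u v} → Joins b e u v → Joins (not b) e v u
  Joins-sym true  (te≡u , he≡v) = he≡v , te≡u
  Joins-sym false (he≡u , te≡v) = te≡v , he≡u

  Joins-ends : ∀ b {e u v} → Joins b e u v → (u ≡ tail G e ⊎ u ≡ head G e)
  Joins-ends true  (te≡u , _) = inj₁ (sym te≡u)
  Joins-ends false (he≡u , _) = inj₂ (sym he≡u)

  Joins-tail : ∀ b {e u v} {P : V → Set} → Joins b e u v → P u → P v → P (tail G e)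
  Joins-tail true  (refl , _) pu pv = pu
  Joins-tail false (_ , refl) pu pv = pv

  Joins-head : ∀ b {e u v} {P : V → Set} → Joins b e u v → P u → P v → P (head G e)
  Joins-head true  (_ , refl) pu pv = pv
  Joins-head false (refl , _) pu pv = pu

  ∑-≈ : ∀ {A : Set} (xs : List A) {f g : A → ℤ} → (∀ x → f x ≈ g x) → ∑ xs f ≈ ∑ xs g
  ∑-≈ []       eq = ≈-refl
  ∑-≈ (x ∷ xs) eq = ≈-+ (eq x) (∑-≈ xs eq)

  -- Signed sums along circuits

  module _ (φ : E → Fin p) where

    module _ (C : Circuit G) where
      open Circuit C

      forward backward : Fin len → ℕ
      forward  i = if dir i then toℕ (φ (arc i)) else 0
      backward i = if dir i then 0 else toℕ (φ (arc i))

      circuitSum : ℤ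
      circuitSum = ∑ (allFin len) (λ i → signed (dir i) (ι (φ (arc i))))

      circuitSum≡ : + Σ[<] len forward - + Σ[<] len backward ≡ circuitSum
      circuitSum≡ = begin
        + Σ[<] len forward - + Σ[<] len backward
          ≡⟨ cong₂ _-_ (pos-Σ len forward) (pos-Σ len backward) ⟩
        ∑ (allFin len) (λ i → + forward i) - ∑ (allFin len) (λ i → + backward i)
          ≡⟨ ∑-minus (allFin len) (λ i → + forward i) (λ i → + backward i) ⟨
        ∑ (allFin len) (λ i → + forward i - + backward i)
          ≡⟨ ∑-cong (allFin len) (λ i → signed≡ (dir i) (toℕ (φ (arc i)))) ⟩
        circuitSum ∎
        where
        signed≡ : ∀ b x → + (if b then x else 0) - + (if b then 0 else x) ≡ signed b (+ x)
        signed≡ true  x = ℤ.+-identityʳ (+ x)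
        signed≡ false x = ℤ.+-identityˡ (- + x)

      circuitSum≈0⇒ : circuitSum ≈ 0ℤ → Σ[<] len forward ℕ.% p ≡ Σ[<] len backward ℕ.% p
      circuitSum≈0⇒ sum≈0 = ≈⇒%≡ {Σ[<] len forward} {Σ[<] len backward}
        (-≈0⇒≈ (≈-trans (≈-reflexive circuitSum≡) sum≈0))

      circuitSum≈0⇐ : Σ[<] len forward ℕ.% p ≡ Σ[<] len backward ℕ.% p → circuitSum ≈ 0ℤ
      circuitSum≈0⇐ eq = ≈-trans (≈-reflexive (sym circuitSum≡))
        (≈⇒-≈0 (%≡⇒≈ {Σ[<] len forward} {Σ[<] len backward} eq))

    -- Stated for a single arc, so that a potential can be required to fit only part of the arcs.
    PotentialOn : (V → ℤ) → E → Set
    PotentialOn π e = ι (φ e) ≈ π (head G e) - π (tail G e)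

    signed-step : ∀ {π} b {e u v} → PotentialOn π e → Joins b e u v → signed b (ι (φ e)) ≈ π v - π u
    signed-step     true  pot (refl , refl) = pot
    signed-step {π} false {e} pot (refl , refl) =
      ≈-trans (≈-neg pot) (≈-reflexive (eq (π (head G e)) (π (tail G e))))
      where
      eq : ∀ a b → - (a - b) ≡ b - a
      eq = solve-∀

    -- Each step contributes the difference of the potential at consecutive vertices, and these
    -- differences telescope around the circuit.
    tension⇒dualFlow : Tension (tail G) (head G) φ → IsDualFlow G p φ
    tension⇒dualFlow (ρ , φ≡δρ) C = circuitSum≈0⇒ C
      (≈-trans (∑-≈ (allFin len) (λ i → signed-step {π} (dir i) (pot (arc i)) (step i))) (≈-reflexive telescope))
      where
      open Circuit C
      π : V → ℤ
      π v = ι (lookup ρ v)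
      pot : ∀ e → PotentialOn π e
      pot e = ≈-trans (≈-reflexive (cong ι (φ≡δρ e))) (ι-red _)
      telescope : ∑ (allFin len) (λ i → π (vert (next i)) - π (vert i)) ≡ 0ℤ
      telescope = begin
        ∑ (allFin len) (λ i → π (vert (next i)) - π (vert i))
          ≡⟨ ∑-minus (allFin len) (λ i → π (vert (next i))) (λ i → π (vert i)) ⟩
        ∑ (allFin len) (π ∘ vert ∘ next) - ∑ (allFin len) (π ∘ vert)
          ≡⟨ cong (_- ∑ (allFin len) (π ∘ vert)) (∑-next len (π ∘ vert)) ⟩
        ∑ (allFin len) (π ∘ vert) - ∑ (allFin len) (π ∘ vert)
          ≡⟨ ℤ.+-inverseʳ (∑ (allFin len) (π ∘ vert)) ⟩
        0ℤ ∎

  -- Walks and simple paths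

  Step : List E → V → V → Set
  Step es u v = ∃₂ λ e b → e ∈ es × Joins b e u v

  Step-sym : ∀ {es u v} → Step es u v → Step es v u
  Step-sym (e , b , e∈es , j) = e , not b , e∈es , Joins-sym b j

  -- The length is an index, so that vertices and arcs can be numbered by `Fin` as in a `Circuit`.
  data Path (es : List E) : V → V → ℕ → Set where
    nil  : ∀ {u} → Path es u u 0
    cons : ∀ {u v w l} → Step es u v → Path es v w l → Path es u w (suc l)

  verts : ∀ {es u w l} → Path es u w l → Fin (suc l) → V
  verts {u = u} r          zero    = u
  verts         (cons _ r) (suc i) = verts r i

  Simple : ∀ {es u w l} → Path es u w l → Set
  Simple         nil        = ⊤
  Simple {u = u} (cons _ r) = (∀ i → verts r i ≢ u) × Simple r

  SimplePath : List E → V → V → Set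
  SimplePath es u w = ∃ λ l → Σ (Path es u w l) Simple

  suffix : ∀ {es u w l} (r : Path es u w l) → Simple r → ∀ i → SimplePath es (verts r i) w
  suffix r          s        zero    = _ , r , s
  suffix (cons _ r) (_ , s)  (suc i) = suffix r s i

  -- If the new starting vertex already lies on the simple path found for the rest of the walk, only
  -- the part of that path from this vertex on is kept.
  loopErase : ∀ {es u w} → Star (Step es) u w → SimplePath es u w
  loopErase ε = 0 , nil , tt
  loopErase {es} {u} {w} (st ◅ walk) with loopErase walk
  ... | l , r , s with anyFin? (λ i → verts r i ≟ u)
  ... | yes (i , eq) = subst (λ x → SimplePath es x w) eq (suffix r s i)
  ... | no  ∄i       = suc l , cons st r , (λ i eq → ∄i (i , eq)) , s

  verts-injective : ∀ {es u w l} (r : Path es u w l) → Simple r → Injective _≡_ _≡_ (verts r)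
  verts-injective r          s             {zero}  {zero}  eq = refl
  verts-injective (cons _ r) (fresh , s)   {zero}  {suc j} eq = contradiction (sym eq) (fresh j)
  verts-injective (cons _ r) (fresh , s)   {suc i} {zero}  eq = contradiction eq (fresh i)
  verts-injective (cons _ r) (fresh , s)   {suc i} {suc j} eq = cong suc (verts-injective r s eq)

  -- Closing a simple path to a circuit

  module Closing {es : List E} (e₀ : E) (e₀∉es : e₀ ∉ es) where

    -- The last index carries the closing arc `e₀`. A path with `l` arcs thus gives `suc l` arcs, as
    -- many as it has vertices; the empty path gives a loop.
    arcAt : ∀ {u w l} → Path es u w l → Fin (suc l) → E
    arcAt nil                zero    = e₀
    arcAt (cons (e , _) r)   zero    = e
    arcAt (cons _       r)   (suc i) = arcAt r i

    dirAt : ∀ {u w l} → Path es u w l → Fin (suc l) → Bool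
    dirAt nil                  zero    = true
    dirAt (cons (_ , b , _) r) zero    = b
    dirAt (cons _           r) (suc i) = dirAt r i

    -- The vertex following the last one is a parameter `z`, because the recursion changes the
    -- starting vertex of the path.
    nextVert : ∀ {u w l} → V → Path es u w l → Fin (suc l) → V
    nextVert z nil                  zero    = z
    nextVert z (cons {v = v} _ r)   zero    = v
    nextVert z (cons _         r)   (suc i) = nextVert z r i

    nextVert-inject₁ : ∀ {u w l} z (r : Path es u w l) i → nextVert z r (inject₁ i) ≡ verts r (suc i)
    nextVert-inject₁ z (cons _ r)          zero    = refl
    nextVert-inject₁ z (cons _ r)          (suc i) = nextVert-inject₁ z r i

    nextVert-fromℕ : ∀ {u w l} z (r : Path es u w l) → nextVert z r (fromℕ l) ≡ z
    nextVert-fromℕ z nil        = refl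
    nextVert-fromℕ z (cons _ r) = nextVert-fromℕ z r

    nextVert≡ : ∀ {u w l} (r : Path es u w l) i → nextVert u r i ≡ verts r (next i)
    nextVert≡ {u} {l = l} r i with view i
    ... | ‵fromℕ     = trans (nextVert-fromℕ u r) (cong (verts r) (sym (next-fromℕ l)))
    ... | ‵inject₁ j = trans (nextVert-inject₁ u r j) (cong (verts r) (sym (next-inject₁ j)))

    joins : ∀ {u l} (r : Path es u (tail G e₀) l) i →
      Joins (dirAt r i) (arcAt r i) (verts r i) (nextVert (head G e₀) r i)
    joins nil                        zero    = refl , refl
    joins (cons (_ , _ , _ , j) r)   zero    = j
    joins (cons _               r)   (suc i) = joins r i

    OnPath : ∀ {u w l} → Path es u w l → V → Set
    OnPath r x = ∃ λ i → verts r i ≡ x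

    onPath-cons : ∀ {u v w l} {st : Step es u v} (r : Path es v w l) {x} → OnPath r x → OnPath (cons st r) x
    onPath-cons r (i , eq) = suc i , eq

    arcAt-ends : ∀ {u w l} (r : Path es u w l) i →
      arcAt r i ≡ e₀ ⊎ (arcAt r i ∈ es × OnPath r (tail G (arcAt r i)) × OnPath r (head G (arcAt r i)))
    arcAt-ends nil zero = inj₁ refl
    arcAt-ends (cons (e , b , e∈es , j) r) zero = inj₂ (e∈es ,
      Joins-tail b {P = OnPath (cons (e , b , e∈es , j) r)} j (zero , refl) (suc zero , refl) ,
      Joins-head b {P = OnPath (cons (e , b , e∈es , j) r)} j (zero , refl) (suc zero , refl))
    arcAt-ends (cons st r) (suc i) with arcAt-ends r i
    ... | inj₁ eq = inj₁ eq
    ... | inj₂ (∈es , on-tail , on-head) = inj₂ (∈es , onPath-cons {st = st} r on-tail , onPath-cons {st = st} r on-head)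

    -- An arc of `es` on the remaining path has both ends there, whereas `e` has `u` as an end. The
    -- closing arc differs from `e` since it is outside `es`.
    arcAt-fresh : ∀ {u v w l} ((e , b , e∈es , j) : Step es u v) (r : Path es v w l) →
      (∀ i → verts r i ≢ u) → ∀ i → arcAt r i ≢ e
    arcAt-fresh (e , b , e∈es , j) r fresh i refl with arcAt-ends r i
    ... | inj₁ eq = e₀∉es (subst (_∈ es) eq e∈es)
    ... | inj₂ (_ , (i₁ , eq₁) , (i₂ , eq₂)) with Joins-ends b j
    ...   | inj₁ u≡tail = fresh i₁ (trans eq₁ (sym u≡tail))
    ...   | inj₂ u≡head = fresh i₂ (trans eq₂ (sym u≡head))

    arcAt-injective : ∀ {u w l} (r : Path es u w l) → Simple r → Injective _≡_ _≡_ (arcAt r)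
    arcAt-injective nil         s           {zero}  {zero}  eq = refl
    arcAt-injective (cons st r) s           {zero}  {zero}  eq = refl
    arcAt-injective (cons st r) (fresh , s) {zero}  {suc j} eq = contradiction (sym eq) (arcAt-fresh st r fresh j)
    arcAt-injective (cons st r) (fresh , s) {suc i} {zero}  eq = contradiction eq (arcAt-fresh st r fresh i)
    arcAt-injective (cons st r) (fresh , s) {suc i} {suc j} eq = cong suc (arcAt-injective r s eq)

    -- The path leads from the head of `e₀` to its tail, and `e₀` traversed forward returns to the
    -- start.
    circuit : ∀ {l} (r : Path es (head G e₀) (tail G e₀) l) → Simple r → Circuit G
    circuit {l} r s = record
      { len      = suc l
      ; len≥1    = ℕ.s≤s ℕ.z≤n
      ; arc      = arcAt r
      ; dir      = dirAt r
      ; vert     = verts r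
      ; arc-inj  = arcAt-injective r s
      ; vert-inj = verts-injective r s
      ; step     = λ i → subst (Joins (dirAt r i) (arcAt r i) (verts r i)) (nextVert≡ r i) (joins r i)
      }

    closedSum : ∀ φ π → (∀ {e} → e ∈ es → PotentialOn φ π e) → ∀ {u w l} (r : Path es u w l) →
      ∑ (allFin (suc l)) (λ i → signed (dirAt r i) (ι (φ (arcAt r i)))) ≈ (π w - π u) + ι (φ e₀)
    closedSum φ π pot {u} nil = ≈-reflexive (eq (ι (φ e₀)) (π u))
      where
      eq : ∀ a b → a + 0ℤ ≡ (b - b) + a
      eq = solve-∀
    closedSum φ π pot {u} {w} {suc l} (cons {v = v} st@(e , b , e∈es , j) r) =
      ≈-trans (≈-reflexive (∑-allFin-suc (suc l) (λ i → signed (dirAt (cons st r) i) (ι (φ (arcAt (cons st r) i))))))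
        (≈-trans (≈-+ (signed-step φ {π} b (pot e∈es) j) (closedSum φ π pot r))
          (≈-reflexive (eq (π u) (π v) (π w) (ι (φ e₀)))))
      where
      eq : ∀ a b c d → (b - a) + ((c - b) + d) ≡ (c - a) + d
      eq = solve-∀

  -- Building a potential arc by arc

  module _ (φ : E → Fin p) (dual : IsDualFlow G p φ) where

    -- The dual flow condition on the circuit formed by `e₀` and the path expresses the value of
    -- `e₀` by the potential at its ends.
    close : ∀ {es} e₀ → e₀ ∉ es → ∀ {π} → (∀ {e} → e ∈ es → PotentialOn φ π e) →
      SimplePath es (head G e₀) (tail G e₀) → PotentialOn φ π e₀
    close e₀ e₀∉es {π} pot (l , r , s) = ≈-sym (-≈0⇒≈ (≈-trans (≈-reflexive (eq (π (head G e₀)) (π (tail G e₀)) (ι (φ e₀))))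
      (≈-neg (≈-trans (≈-sym (closedSum φ π pot r)) sum≈0))))
      where
      open Closing e₀ e₀∉es
      sum≈0 : circuitSum φ (circuit r s) ≈ 0ℤ
      sum≈0 = circuitSum≈0⇐ φ (circuit r s) (dual (circuit r s))
      eq : ∀ a b c → (a - b) - c ≡ - ((b - a) + c)
      eq = solve-∀

    -- The labels `component` mark the connected components of the arcs in `es`: `joined` keeps
    -- labels constant along arcs, and `walk` connects vertices of equal label. Connectedness
    -- thereby becomes decidable.
    record PartialPotential (es : List E) : Set where
      field
        π         : V → ℤ
        component : V → V
        pot       : ∀ {e} → e ∈ es → PotentialOn φ π e
        joined    : ∀ {e} → e ∈ es → component (head G e) ≡ component (tail G e)
        walk      : ∀ {u v} → component u ≡ component v → Star (Step es) u v

    weaken : ∀ {es e u v} → Star (Step es) u v → Star (Step (e ∷ es)) u v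
    weaken = Star.map λ (e′ , b , e′∈es , j) → e′ , b , there e′∈es , j

    module _ {es : List E} (P : PartialPotential es) (e : E) where
      open PartialPotential P
      private
        u = tail G e
        v = head G e

      addCycle : PotentialOn φ π e → component v ≡ component u → PartialPotential (e ∷ es)
      addCycle pot-e joined-e = record
        { π         = π
        ; component = component
        ; pot       = λ { (here refl) → pot-e ; (there e∈) → pot e∈ }
        ; joined    = λ { (here refl) → joined-e ; (there e∈) → joined e∈ }
        ; walk      = λ eq → weaken (walk eq)
        }

      -- Shifting the potential on the component of the head makes it fit the new arc.
      addBridge : component u ≢ component v → PartialPotential (e ∷ es)
      addBridge u≁v = record
        { π         = π′
        ; component = component′
        ; pot       = λ { (here refl) → pot-e ; (there e∈) → pot-es e∈ }
        ; joined    = λ { (here refl) → joined-e ; {e = e′} (there e∈) → cong relabel (joined e∈) }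
        ; walk      = walk′
        }
        where
        -- The solution of `(π v + s) - π u ≡ ι (φ e)`.
        s = (π u + ι (φ e)) - π v
        π′ : V → ℤ
        π′ w = π w + χ (component w ≟ component v) * s
        relabel : V → V
        relabel c = if does (c ≟ component v) then component u else c
        component′ : V → V
        component′ w = relabel (component w)

        pot-e : PotentialOn φ π′ e
        pot-e = ≈-reflexive (sym (begin
          (π v + χ (component v ≟ component v) * s) - (π u + χ (component u ≟ component v) * s)
            ≡⟨ cong₂ (λ a b → (π v + a * s) - (π u + b * s))
                 (χ-yes (component v ≟ component v) refl) (χ-no (component u ≟ component v) u≁v) ⟩
          (π v + 1ℤ * s) - (π u + 0ℤ * s)
            ≡⟨ eq (π v) (π u) (ι (φ e)) ⟩
          ι (φ e) ∎))
          where
          eq : ∀ a b c → (a + 1ℤ * ((b + c) - a)) - (b + 0ℤ * ((b + c) - a)) ≡ c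
          eq = solve-∀

        -- Both ends of an old arc have the same label, so they are shifted together or not at all.
        pot-es : ∀ {e′} → e′ ∈ es → PotentialOn φ π′ e′
        pot-es {e′} e′∈es = ≈-trans (pot e′∈es) (≈-reflexive (sym (begin
          π′ (head G e′) - π′ (tail G e′)
            ≡⟨ cong (λ c → (π (head G e′) + χ (c ≟ component v) * s) - π′ (tail G e′)) (joined e′∈es) ⟩
          (π (head G e′) + x) - (π (tail G e′) + x)
            ≡⟨ eq (π (head G e′)) (π (tail G e′)) x ⟩
          π (head G e′) - π (tail G e′) ∎)))
          where
          x = χ (component (tail G e′) ≟ component v) * s
          eq : ∀ a b x → (a + x) - (b + x) ≡ a - b
          eq = solve-∀

        relabel-≡ : ∀ {c} → c ≡ component v → relabel c ≡ component u
        relabel-≡ {c} eq with c ≟ component v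
        ... | yes _ = refl
        ... | no ≢  = contradiction eq ≢

        relabel-≢ : ∀ {c} → c ≢ component v → relabel c ≡ c
        relabel-≢ {c} ≢ with c ≟ component v
        ... | yes eq = contradiction eq ≢
        ... | no _   = refl

        joined-e : component′ v ≡ component′ u
        joined-e = trans (relabel-≡ refl) (sym (relabel-≢ u≁v))

        -- The walk passes from the component of the head to that of the tail, so `e` is traversed
        -- backward.
        cross : ∀ {w₁ w₂} → component w₁ ≡ component v → component w₂ ≡ component u → Star (Step (e ∷ es)) w₁ w₂
        cross w₁~v w₂~u = weaken (walk w₁~v) ◅◅ (e , false , here refl , refl , refl) ◅ weaken (walk (sym w₂~u))

        walk′ : ∀ {w₁ w₂} → component′ w₁ ≡ component′ w₂ → Star (Step (e ∷ es)) w₁ w₂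
        walk′ {w₁} {w₂} eq with component w₁ ≟ component v | component w₂ ≟ component v
        -- Once both decisions are known, `relabel` computes, and in the mixed cases `eq` compares a
        -- label with `component u`.
        ... | yes w₁~v | yes w₂~v = weaken (walk (trans w₁~v (sym w₂~v)))
        ... | yes w₁~v | no  w₂≁v = cross w₁~v (sym eq)
        ... | no  w₁≁v | yes w₂~v = Star.reverse Step-sym (cross w₂~v eq)
        ... | no  w₁≁v | no  w₂≁v = weaken (walk eq)

      -- A circuit has distinct arcs, so closing one needs `e ∉ es`, and an arc already present is
      -- treated first. A loop at a vertex falls under the case of equal labels.
      addArc : PartialPotential (e ∷ es)
      addArc with mem? _≟_ e es | component v ≟ component u
      ... | yes e∈es | _        = addCycle (pot e∈es) (joined e∈es)
      ... | no  e∉es | yes v~u  = addCycle (close e e∉es {π} pot (loopErase (walk v~u))) v~u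
      ... | no  e∉es | no  v≁u  = addBridge (v≁u ∘ sym)

    partialPotential : ∀ es → PartialPotential es
    partialPotential []       = record
      { π = λ _ → 0ℤ ; component = id ; pot = λ () ; joined = λ () ; walk = λ { refl → ε } }
    partialPotential (e ∷ es) = addArc (partialPotential es) e

    dualFlow⇒tension : Tension (tail G) (head G) φ
    dualFlow⇒tension = ρ , λ e → ι-injective (≈-trans (pot (∈-allFin e))
      (≈-trans (≈-- (≈-sym (ρ≈π (head G e))) (≈-sym (ρ≈π (tail G e)))) (≈-sym (ι-red _))))
      where
      open PartialPotential (partialPotential (allFin (m G)))
      ρ : Vec (Fin p) (n G)
      ρ = tabulate (red ∘ π)
      ρ≈π : ∀ v → ι (lookup ρ v) ≈ π v
      ρ≈π v = ≈-trans (≈-reflexive (cong ι (Vec.lookup∘tabulate (red ∘ π) v))) (ι-red (π v))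

-- Counts as sums of indicators

module _ {k l : ℕ} {P : (Fin k → Fin l) → Set} (P? : ∀ v → Dec (P (lookup v))) where

  hasCount-filter : HasCount P (length (filter P? (maps l k)))
  hasCount-filter = filter P? (maps l k) , filter⁺ P? (maps-unique l k) , refl , all-filter P? (maps l k) ,
    λ v Pv → ∈-filter⁺ P? (∈-maps v) Pv

  -- Two duplicate-free lists with the same members are permutations of each other, so the given
  -- list is as long as the filtered enumeration.
  hasCount⇒∑ : ∀ {c} → HasCount P c → + c ≡ ∑ (maps l k) (χ ∘ P?)
  hasCount⇒∑ (xs , unique , refl , all-P , complete) = trans
    (cong +_ (↭-length (∼bag⇒↭ (unique∧set⇒bag unique (filter⁺ P? (maps-unique l k))
      (mk⇔ (λ v∈xs → ∈-filter⁺ P? (∈-maps _) (All.lookup all-P v∈xs))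
           (λ v∈ → complete _ (proj₂ (∈-filter⁻ P? {xs = maps l k} v∈))))))))
    (length-filter-χ P? (maps l k))

-- Nowhere-zero flows and unbalanced counts

module Main (q : ℕ) (G : Digraph) where
  open Modular q
  open Duality q
  open Tensions q G

  private
    t = tail G
    h = head G

  module _ (φ : Fin (m G) → Fin p) (v : Fin (n G)) where

    inflow outflow : Fin (m G) → ℕ
    inflow  e = if does (h e ≟ v) then toℕ (φ e) else 0
    outflow e = if does (t e ≟ v) then toℕ (φ e) else 0

    imbalance≡ : + Σ[<] (m G) inflow - + Σ[<] (m G) outflow ≡ imbalance t h φ v
    imbalance≡ = begin
      + Σ[<] (m G) inflow - + Σ[<] (m G) outflow
        ≡⟨ cong₂ _-_ (pos-Σ (m G) inflow) (pos-Σ (m G) outflow) ⟩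
      ∑ (allFin (m G)) (λ e → + inflow e) - ∑ (allFin (m G)) (λ e → + outflow e)
        ≡⟨ ∑-minus (allFin (m G)) (λ e → + inflow e) (λ e → + outflow e) ⟨
      ∑ (allFin (m G)) (λ e → + inflow e - + outflow e)
        ≡⟨ ∑-cong (allFin (m G)) (λ e → distrib (does (h e ≟ v)) (does (t e ≟ v)) (toℕ (φ e))) ⟩
      imbalance t h φ v ∎
      where
      if-* : ∀ b x → + (if b then x else 0) ≡ (if b then 1ℤ else 0ℤ) * + x
      if-* true  x = sym (ℤ.*-identityˡ (+ x))
      if-* false x = refl
      eq : ∀ a b x → a * x - b * x ≡ (a - b) * x
      eq = solve-∀
      distrib : ∀ b c x → + (if b then x else 0) - + (if c then x else 0)
        ≡ ((if b then 1ℤ else 0ℤ) - (if c then 1ℤ else 0ℤ)) * + x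
      distrib b c x = trans (cong₂ _-_ (if-* b x) (if-* c x)) (eq (if b then 1ℤ else 0ℤ) (if c then 1ℤ else 0ℤ) (+ x))

  isFlow⇒Flow : ∀ φ → IsFlow G p φ → Flow t h φ
  isFlow⇒Flow φ flow v = ≈-trans (≈-reflexive (sym (imbalance≡ φ v)))
    (≈⇒-≈0 (%≡⇒≈ {Σ[<] (m G) (inflow φ v)} {Σ[<] (m G) (outflow φ v)} (flow v)))

  Flow⇒isFlow : ∀ φ → Flow t h φ → IsFlow G p φ
  Flow⇒isFlow φ flow v = ≈⇒%≡ {Σ[<] (m G) (inflow φ v)} {Σ[<] (m G) (outflow φ v)}
    (-≈0⇒≈ (≈-trans (≈-reflexive (imbalance≡ φ v)) (flow v)))

  -- Serves to pass from a map to its tabulated vector, with which it agrees only pointwise.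
  Flow-cong : ∀ {φ φ′} → (∀ e → φ e ≡ φ′ e) → Flow t h φ → Flow t h φ′
  Flow-cong eq flow v = ≈-trans (≈-reflexive (∑-cong (allFin (m G)) λ e →
    cong (λ x → (χ (h e ≟ v) - χ (t e ≟ v)) * ι x) (sym (eq e)))) (flow v)

  potentialSum≢0⇔#nzFlows≢0 : potentialSum t h ≢ 0ℤ ⇔ #nzFlows t h ≢ 0ℤ
  potentialSum≢0⇔#nzFlows≢0 = mk⇔
    (λ P≢0 → *-≢0⁻ʳ ((+ p) ^ n G) (subst (_≢ 0ℤ) (potentialSum≡ (m G) t h) P≢0))
    (λ #≢0 → subst (_≢ 0ℤ) (sym (potentialSum≡ (m G) t h)) (*-≢0 (p^≢0 (n G)) #≢0))

  -- The condition ranges over all circuits; it is decided by searching for a potential instead.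
  isDualFlow? : ∀ φ → Dec (IsDualFlow G p φ)
  isDualFlow? φ = map′ (tension⇒dualFlow φ) (dualFlow⇒tension φ) (tension? t h φ)

  module _ (ψ : Fin (m G) → Fin q) where

    EvenDual OddDual : (Fin (m G) → Fin p) → Set
    EvenDual φ = IsDualFlow G p φ × Conformal {p = p} ψ φ × IsEven φ
    OddDual  φ = IsDualFlow G p φ × Conformal {p = p} ψ φ × IsOdd φ

    evenDual? : ∀ φ → Dec (EvenDual φ)
    evenDual? φ = isDualFlow? φ ×-dec (conformal? ψ φ ×-dec (#top φ ℕ.% 2 ℕ.≟ 0))

    oddDual? : ∀ φ → Dec (OddDual φ)
    oddDual? φ = isDualFlow? φ ×-dec (conformal? ψ φ ×-dec (#top φ ℕ.% 2 ℕ.≟ 1))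

    χ-even-odd : ∀ φ → χ (evenDual? φ) - χ (oddDual? φ) ≡ χ (tension? t h φ) * (χ (conformal? ψ φ) * sign (#top φ))
    χ-even-odd φ = begin
      χ (evenDual? φ) - χ (oddDual? φ)
        ≡⟨ cong₂ _-_ (trans (χ-× d? (c? ×-dec e?)) (cong (χ d? *_) (χ-× c? e?)))
                     (trans (χ-× d? (c? ×-dec o?)) (cong (χ d? *_) (χ-× c? o?))) ⟩
      χ d? * (χ c? * χ e?) - χ d? * (χ c? * χ o?)
        ≡⟨ eq (χ d?) (χ c?) (χ e?) (χ o?) ⟩
      χ d? * (χ c? * sign (#top φ)) ∎
      where
      d? = isDualFlow? φ
      c? = conformal? ψ φ
      e? = #top φ ℕ.% 2 ℕ.≟ 0
      o? = #top φ ℕ.% 2 ℕ.≟ 1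
      eq : ∀ a b c d → a * (b * c) - a * (b * d) ≡ a * (b * (c - d))
      eq = solve-∀

    -- The difference of the counts is the sum of `sign` over the conformal tensions, by the
    -- agreement of dual flows with tensions.
    counts⇒signedSum : ∀ {k₁ k₂} → HasCount EvenDual k₁ → HasCount OddDual k₂ →
      signedSum t h ψ ≡ (+ k₁ - + k₂) * #constant t h
    counts⇒signedSum {k₁} {k₂} c₁ c₂ = trans (signedSum≡ t h ψ) (cong (_* #constant t h) (sym (begin
      + k₁ - + k₂
        ≡⟨ cong₂ _-_ (hasCount⇒∑ {P = EvenDual} (evenDual? ∘ lookup) c₁) (hasCount⇒∑ {P = OddDual} (oddDual? ∘ lookup) c₂) ⟩
      ∑ Y (χ ∘ evenDual? ∘ lookup) - ∑ Y (χ ∘ oddDual? ∘ lookup)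
        ≡⟨ ∑-minus Y (χ ∘ evenDual? ∘ lookup) (χ ∘ oddDual? ∘ lookup) ⟨
      ∑ Y (λ φ → χ (evenDual? (lookup φ)) - χ (oddDual? (lookup φ)))
        ≡⟨ ∑-cong Y (χ-even-odd ∘ lookup) ⟩
      ∑ Y (λ φ → χ (tension? t h (lookup φ)) * (χ (conformal? ψ (lookup φ)) * sign (#top (lookup φ)))) ∎)))
      where Y = maps p (m G)

    Unbalanced : Set
    Unbalanced = ∀ (k₁ k₂ : ℕ) → HasCount EvenDual k₁ → HasCount OddDual k₂ → k₁ ≢ k₂

    signedSum≢0⇒unbalanced : signedSum t h ψ ≢ 0ℤ → Unbalanced
    signedSum≢0⇒unbalanced S≢0 k₁ k₂ c₁ c₂ refl = S≢0 (trans (counts⇒signedSum c₁ c₂)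
      (cong (_* #constant t h) (ℤ.+-inverseʳ (+ k₁))))

    -- `Unbalanced` speaks of all possible counts, so actual ones are produced by filtering the
    -- enumeration of maps.
    unbalanced⇒signedSum≢0 : Unbalanced → signedSum t h ψ ≢ 0ℤ
    unbalanced⇒signedSum≢0 unb = subst (_≢ 0ℤ) (sym (counts⇒signedSum c₁ c₂))
      (*-≢0 (λ k₁-k₂≡0 → unb _ _ c₁ c₂ (ℤ.+-injective (ℤ.i-j≡0⇒i≡j _ _ k₁-k₂≡0))) (#constant≢0 t h))
      where
      c₁ = hasCount-filter {P = EvenDual} (evenDual? ∘ lookup)
      c₂ = hasCount-filter {P = OddDual} (oddDual? ∘ lookup)

  nzFlow⇔unbalanced : (Σ (Fin (m G) → Fin p) λ φ → IsFlow G p φ × NowhereZero φ) ⇔ Σ (Fin (m G) → Fin q) Unbalanced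
  nzFlow⇔unbalanced = mk⇔ to from
    where
    open Equivalence potentialSum≢0⇔#nzFlows≢0 renaming (to to P⇒#; from to #⇒P)

    to : (Σ (Fin (m G) → Fin p) λ φ → IsFlow G p φ × NowhereZero φ) → Σ (Fin (m G) → Fin q) Unbalanced
    to (φ , flow , nz) =
      let ψ , S≢0 = potentialSum≢0⇒signedSum≢0 t h (#⇒P (nzFlow⇒#nzFlows≢0 t h (tabulate φ)
            (Flow-cong (λ e → sym (Vec.lookup∘tabulate φ e)) (isFlow⇒Flow φ flow))
            (λ e eq → nz e (cong toℕ (trans (sym (Vec.lookup∘tabulate φ e)) eq)))))
      in lookup ψ , signedSum≢0⇒unbalanced (lookup ψ) S≢0

    from : Σ (Fin (m G) → Fin q) Unbalanced → Σ (Fin (m G) → Fin p) λ φ → IsFlow G p φ × NowhereZero φ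
    from (ψ , unb) =
      let φ , flow , nz = #nzFlows≢0⇒nzFlow t h
            (P⇒# (signedSum≢0⇒potentialSum≢0 t h ψ (unbalanced⇒signedSum≢0 ψ unb)))
      in lookup φ , Flow⇒isFlow (lookup φ) flow , λ e eq → nz e (toℕ-injective eq)

theorem1p2 : (G : Digraph) (p : ℕ) (p≥2 : p ≥ 2) →
    let instance _ = >-nonZero (≤-trans (s≤s z≤n) p≥2) in
    (Σ (Fin (m G) → Fin p) λ φ → IsFlow G p φ × NowhereZero φ)
    ⇔ (Σ (Fin (m G) → Fin (p ∸ 1)) λ ψ → ∀ (k₁ k₂ : ℕ) →
    HasCount (λ φ → IsDualFlow G p φ × Conformal ψ φ × IsEven φ) k₁ →
    HasCount (λ φ → IsDualFlow G p φ × Conformal ψ φ × IsOdd φ) k₂ →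
    k₁ ≢ k₂)
-- Matching `p` as a successor lets `p ∸ 1` compute to `q`.
theorem1p2 G (suc q) _ = nzFlow⇔unbalanced
  where open Main q G
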